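{- Let $P,Q\in\mathrm{Mat}_d(\mathbb{Q})$. Then $P,Q$ are irreducible if and only if $P$ and $Q$ are invertible and the characteristic polynomial of $P^{ -1}Q$ is irreducible over $\mathbb{Q}$.
   Context: Matrices $P,Q\in\mathrm{Mat}_d(\mathbb{Q})$ are called irreducible if there are no non-trivial subspaces $U,V$ of $\mathbb{Q}^d$ of the same dimension (non-trivial meaning neither $\{0\}$ nor $\mathbb{Q}^d$) such that $PU\subseteq V$ and $QU\subseteq V$.
   Formalization: The formal theorem assumes d ≥ 2; for d ≤ 1 the statement fails, since Q^d then has no non-trivial subspaces and every pair is irreducible (e.g. d = 1, P = Q = 0 is not invertible; for d = 0 the characteristic polynomial is 1). -}

module Defs where

open import Algebra.Bundles.Raw using (RawRing)
import Algebra.Definitions.RawSemiring as RawSemiringDefs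
open import Data.Bool.Base using (if_then_else_)
open import Data.Fin.Base using (toℕ)
open import Data.Fin.Properties using (_≟_)
open import Data.List.Base as List using (List; []; _∷_)
open import Data.Nat.Base using (ℕ; zero; suc)
open import Data.Product.Base using (Σ-syntax; ∃-syntax; _×_)
open import Data.Rational.Base using (ℚ; 0ℚ; 1ℚ; _+_; _*_; -_; +-*-rawRing)
open import Data.Vec.Functional using (Vector; head; tail; map; removeAt)
open import Level using (0ℓ; _⊔_)
open import Relation.Binary.PropositionalEquality using (_≗_)
open import Relation.Nullary using (¬_)
open import Relation.Nullary.Decidable.Core using (⌊_⌋)
open import Relation.Unary using (Pred; _∈_; _⊆_)

Matrix : ∀ {a} → Set a → ℕ → ℕ → Set a
Matrix A m n = Vector (Vector A n) m

module MatrixOps {c ℓ} (R : RawRing c ℓ) where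
  private module R = RawRing R
  open RawSemiringDefs R.rawSemiring using (sum; _^_)

  infixl 7 _*ᴹ_
  infix  4 _≈ᴹ_

  _≈ᴹ_ : ∀ {m n} → Matrix R.Carrier m n → Matrix R.Carrier m n → Set ℓ
  A ≈ᴹ B = ∀ i j → A i j R.≈ B i j

  1ᴹ : ∀ {n} → Matrix R.Carrier n n
  1ᴹ i j = if ⌊ i ≟ j ⌋ then R.1# else R.0#

  _*ᴹ_ : ∀ {l m n} → Matrix R.Carrier l m → Matrix R.Carrier m n → Matrix R.Carrier l n
  (A *ᴹ B) i k = sum (λ j → A i j R.* B j k)

  -- Laplace expansion along the first row.
  det : ∀ {n} → Matrix R.Carrier n n → R.Carrier
  det {zero}  A = R.1#
  det {suc n} A = sum (λ j →
    (R.- R.1#) ^ toℕ j R.* (head A j R.* det (map (λ row → removeAt row j) (tail A))))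

  record Invertible {n} (A : Matrix R.Carrier n n) : Set (c ⊔ ℓ) where
    field
      inverse  : Matrix R.Carrier n n
      inverseˡ : inverse *ᴹ A ≈ᴹ 1ᴹ
      inverseʳ : A *ᴹ inverse ≈ᴹ 1ᴹ

open MatrixOps +-*-rawRing public using (_*ᴹ_; Invertible)
open RawSemiringDefs (RawRing.rawSemiring +-*-rawRing) using (sum)

-- Coefficient lists, constant term first.  Trailing zeros are allowed, so
-- equality of polynomials is _≈ᴾ_ rather than _≡_.
Poly : Set
Poly = List ℚ

coeff : Poly → ℕ → ℚ
coeff []      _       = 0ℚ
coeff (a ∷ p) zero    = a
coeff (a ∷ p) (suc n) = coeff p n

infix  4 _≈ᴾ_
infixl 6 _+ᴾ_
infixl 7 _*ᴾ_
infix  8 -ᴾ_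

_≈ᴾ_ : Poly → Poly → Set
p ≈ᴾ q = coeff p ≗ coeff q

_+ᴾ_ : Poly → Poly → Poly
[]      +ᴾ q       = q
(a ∷ p) +ᴾ []      = a ∷ p
(a ∷ p) +ᴾ (b ∷ q) = (a + b) ∷ (p +ᴾ q)

-ᴾ_ : Poly → Poly
-ᴾ_ = List.map -_

_*ᴾ_ : Poly → Poly → Poly
[]      *ᴾ q = []
(a ∷ p) *ᴾ q = List.map (a *_) q +ᴾ (0ℚ ∷ (p *ᴾ q))

constᴾ : ℚ → Poly
constᴾ a = a ∷ []

X : Poly
X = 0ℚ ∷ 1ℚ ∷ []

ℚ[X] : RawRing 0ℓ 0ℓ
ℚ[X] = record
  { Carrier = Poly
  ; _≈_     = _≈ᴾ_
  ; _+_     = _+ᴾ_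
  ; _*_     = _*ᴾ_
  ; -_      = -ᴾ_
  ; 0#      = []
  ; 1#      = constᴾ 1ℚ
  }

open RawSemiringDefs (RawRing.rawSemiring ℚ[X]) public
  using () renaming (Irreducible to IrreduciblePoly)

charPoly : ∀ {d} → Matrix ℚ d d → Poly
charPoly A = det (λ i j → X *ᴾ 1ᴹ i j +ᴾ (-ᴾ constᴾ (A i j)))
  where open MatrixOps ℚ[X] using (det; 1ᴹ)

infixr 7 _·ᵛ_
_·ᵛ_ : ∀ {m n} → Matrix ℚ m n → Vector ℚ n → Vector ℚ m
(A ·ᵛ v) i = sum (λ j → A i j * v j)

-- Closure under pointwise equality is needed because vectors are functions
-- and function extensionality is not available.
record Subspace (d : ℕ) : Set₁ where
  field
    Carrier  : Pred (Vector ℚ d) 0ℓ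
    resp     : ∀ {u v} → u ≗ v → u ∈ Carrier → v ∈ Carrier
    0-closed : (λ _ → 0ℚ) ∈ Carrier
    +-closed : ∀ {u v} → u ∈ Carrier → v ∈ Carrier → (λ i → u i + v i) ∈ Carrier
    ·-closed : ∀ a {u} → u ∈ Carrier → (λ i → a * u i) ∈ Carrier

open Subspace using (Carrier)

linComb : ∀ {k d} → Vector ℚ k → Vector (Vector ℚ d) k → Vector ℚ d
linComb c b i = sum (λ j → c j * b j i)

record IsBasis {k d} (U : Subspace d) (b : Vector (Vector ℚ d) k) : Set where
  field
    member      : ∀ j → b j ∈ Carrier U
    spanning    : ∀ {u} → u ∈ Carrier U → ∃[ c ] u ≗ linComb c b
    independent : ∀ c → linComb c b ≗ (λ _ → 0ℚ) → c ≗ (λ _ → 0ℚ)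

HasDim : ∀ {d} → Subspace d → ℕ → Set
HasDim {d} U k = Σ[ b ∈ Vector (Vector ℚ d) k ] IsBasis U b

SameDim : ∀ {d} → Subspace d → Subspace d → Set
SameDim U V = ∃[ k ] HasDim U k × HasDim V k

NonTrivial : ∀ {d} → Subspace d → Set
NonTrivial U = ¬ (∀ u → u ∈ Carrier U → u ≗ (λ _ → 0ℚ)) × ¬ (∀ u → u ∈ Carrier U)

image : ∀ {d} → Matrix ℚ d d → Subspace d → Pred (Vector ℚ d) 0ℓ
image A U w = ∃[ u ] u ∈ Carrier U × w ≗ A ·ᵛ u

IrreduciblePair : ∀ {d} → Matrix ℚ d d → Matrix ℚ d d → Set₁
IrreduciblePair {d} P Q =
  ¬ (Σ[ U ∈ Subspace d ] Σ[ V ∈ Subspace d ]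
       NonTrivial U × NonTrivial V × SameDim U V ×
       image P U ⊆ Carrier V × image Q U ⊆ Carrier V)

{-# OPTIONS --safe #-}
module Submission where

-- Everything is read off the Krylov spaces span(v, Av, A²v, …) of A = P⁻¹Q.
-- A singular P or Q is excluded by a line spanned by a kernel vector.  If χ_A = xy
-- with both factors of positive degree, Cayley–Hamilton makes e₀ or y(A)e₀ a nonzero
-- vector killed by a polynomial of degree < d; its Krylov space U is a proper
-- A-invariant subspace, and (U, PU) shows that P, Q is reducible.  Conversely a pair
-- (U, V) forces V = PU by dimension, so U is A-invariant, and the minimal annihilator
-- of a nonzero vector of U has degree between 1 and dim U < d and divides χ_A.
--
-- Cayley–Hamilton holds because the coordinate functionals ε_c satisfy the relations
-- Σ_c (XI − A)_{ic} · ε_c = 0, where X acts by precomposition with A: a submodule of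
-- R^n containing the rows of N contains det N · e_j.

open import Defs
open import Algebra.Bundles using (CommutativeRing)
open import Algebra.Bundles.Raw using (RawRing)
import Algebra.Definitions.RawMagma as Divisibility
import Algebra.Definitions.RawSemiring as RawSemiringDefs
import Algebra.Properties.Ring as RingProperties
import Algebra.Properties.Semiring.Sum as SumProperties
open import Algebra.Structures using (IsCommutativeRing)
open import Data.Bool.Base using (if_then_else_)
open import Data.Fin.Base using (Fin; zero; suc; toℕ; fromℕ<; punchIn; punchOut)
import Data.Fin.Properties as Fin
open import Data.List.Base as List using (List; []; _∷_; _++_)
open import Data.List.Membership.Propositional using () renaming (_∈_ to _∈ˡ_)
open import Data.List.Membership.Propositional.Properties using (∈-∃++; ∈-++⁺ʳ; ∈-++⁻; ∈-allFin)
open import Data.List.Relation.Unary.Any using (here; there)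
open import Data.Nat.Base as ℕ using (ℕ; zero; suc; _≤_; _<_; z≤n; s≤s)
import Data.Nat.Properties as ℕ
open import Data.Product.Base using (Σ-syntax; ∃-syntax; _×_; _,_; proj₁; proj₂)
open import Data.Rational.Base using (ℚ)
open import Data.Sum.Base using (_⊎_; inj₁; inj₂)
open import Data.Vec.Functional using (Vector; toList; removeAt) renaming (_∷_ to _∷ᵛ_)
open import Function.Base using (_∘_)
open import Function.Bundles using (_⇔_; mk⇔)
open import Level using (_⊔_)
open import Relation.Binary.Core using (Rel)
open import Relation.Binary.PropositionalEquality as ≡ using (_≡_; _≢_; _≗_)
import Relation.Binary.Reasoning.Setoid as SetoidReasoning
open import Relation.Nullary using (¬_; Dec; yes; no; contradiction; ¬?)
open import Relation.Nullary.Decidable.Core using (⌊_⌋)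
open import Relation.Unary using (_∈_; _⊆_)

-- Determinants as alternating forms

-- Cayley-Hamilton needs a determinant identity over polynomials, but the characteristic polynomial
-- is a `det` of coefficient lists. Since `det` depends on the raw operations only, the equality is
-- a separate parameter here: the very same `det` can be studied modulo `p(A) = q(A)`, where the
-- ring axioms are identities between operators, and no adjugate has to be built. The bound `2 ≤ d`
-- enters through the invertibility of `P` and `Q`: the subspaces that exclude a kernel vector are
-- lines, which must be proper. For `d = 1` there are no non-trivial subspaces at all, so even the
-- pair of zero matrices counts as irreducible. `IrreduciblePair` is a bare negation, so every case
-- distinction (dependent or not, `y(A)e₀` zero or not, the degree of a factor) must be decided. All
-- of them reduce to equality of rationals.

module AlternatingForms {r ℓ ℓ′} (raw : RawRing r ℓ)
  (_≈_ : Rel (RawRing.Carrier raw) ℓ′)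
  (isCommutativeRing : IsCommutativeRing _≈_ (RawRing._+_ raw) (RawRing._*_ raw)
    (RawRing.-_ raw) (RawRing.0# raw) (RawRing.1# raw))
  where

  private
    R : CommutativeRing r ℓ′
    R = record { isCommutativeRing = isCommutativeRing }
  open CommutativeRing R hiding (_≈_; isCommutativeRing; zero)
  open RingProperties ring using (-‿distribʳ-*; -0#≈0#; -‿+-comm; -1*x≈-x; -‿involutive)
  open SumProperties semiring using (sum; sum-cong-≋; *-distribˡ-sum)
  open RawSemiringDefs (RawRing.rawSemiring raw) using (_^_)
  open MatrixOps raw using (det)
  open SetoidReasoning setoid

  Form : Set → Set r
  Form C = List C → Carrier

  infixr 6 _∧_
  -- This is the exterior product with a 1-form: on a list it is the alternating sum, over the
  -- entries, of `φ` at the entry times `F` on the list without it. Entries already passed are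
  -- stored in `F ∘ (c ∷_)`, so no positions or sign exponents occur.
  _∧_ : {C : Set} → (C → Carrier) → Form C → Form C
  (φ ∧ F) []       = 0#
  (φ ∧ F) (c ∷ cs) = φ c * F cs + - (φ ∧ (F ∘ (c ∷_))) cs

  ⋀ : ∀ {C n} → Vector (C → Carrier) n → Form C
  ⋀ {n = zero}  φ []      = 1#
  ⋀ {n = zero}  φ (_ ∷ _) = 0#
  ⋀ {n = suc n} φ         = φ zero ∧ ⋀ (φ ∘ suc)

  private
    variable
      C : Set
      F G : Form C

  ∧-zero : ∀ (φ : C → Carrier) → (∀ cs → F cs ≈ 0#) → ∀ cs → (φ ∧ F) cs ≈ 0#
  ∧-zero φ F≈0 []       = refl
  ∧-zero {F = F} φ F≈0 (c ∷ cs) = begin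
    φ c * F cs + - (φ ∧ (F ∘ (c ∷_))) cs
      ≈⟨ +-cong (*-congˡ (F≈0 cs)) (-‿cong (∧-zero φ (F≈0 ∘ (c ∷_)) cs)) ⟩
    φ c * 0# + - 0#
      ≈⟨ +-cong (zeroʳ _) -0#≈0# ⟩
    0# + 0#
      ≈⟨ +-identityˡ 0# ⟩
    0# ∎

  ∧-neg : ∀ (φ : C → Carrier) → (∀ cs → F cs ≈ (- G cs)) → ∀ cs → (φ ∧ F) cs ≈ (- (φ ∧ G) cs)
  ∧-neg φ F≈-G [] = sym -0#≈0#
  ∧-neg {F = F} {G = G} φ F≈-G (c ∷ cs) = begin
    φ c * F cs + - (φ ∧ (F ∘ (c ∷_))) cs
      ≈⟨ +-cong (*-congˡ (F≈-G cs)) (-‿cong (∧-neg φ (F≈-G ∘ (c ∷_)) cs)) ⟩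
    φ c * - G cs + - - (φ ∧ (G ∘ (c ∷_))) cs
      ≈⟨ +-congʳ (-‿distribʳ-* _ _) ⟨
    - (φ c * G cs) + - - (φ ∧ (G ∘ (c ∷_))) cs
      ≈⟨ -‿+-comm _ _ ⟩
    - (φ c * G cs + - (φ ∧ (G ∘ (c ∷_))) cs) ∎

  -- Two separate fields, because 2 may be a zero divisor in a general commutative ring, and then
  -- the sign rule for swaps does not force vanishing on a repetition.
  record Alternating {C : Set} (F : Form C) : Set (r ⊔ ℓ′) where
    field
      swap   : ∀ cs x y ds → F (cs ++ x ∷ y ∷ ds) ≈ (- F (cs ++ y ∷ x ∷ ds))
      repeat : ∀ cs x ds → F (cs ++ x ∷ x ∷ ds) ≈ 0#
  open Alternating

  prefix : Alternating F → ∀ c → Alternating (F ∘ (c ∷_))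
  prefix alt c .swap   cs = alt .swap (c ∷ cs)
  prefix alt c .repeat cs = alt .repeat (c ∷ cs)

  -- With both arguments in front, expansion gives `φ x * F (y ∷ ds)` and `φ y * F (x ∷ ds)` with
  -- opposite signs, and a term where `F` receives both. The first two trade places or cancel;
  -- alternation of `F` settles the third. A longer prefix is induction.
  ∧-alternating : (φ : C → Carrier) → Alternating F → Alternating (φ ∧ F)
  ∧-alternating {F = F} φ alt .swap [] x y ds = begin
    φ x * F (y ∷ ds) + - (φ y * F (x ∷ ds) + - Fxy)
      ≈⟨ +-congˡ (-‿+-comm _ _) ⟨
    φ x * F (y ∷ ds) + (- (φ y * F (x ∷ ds)) + - - Fxy)
      ≈⟨ +-congˡ (+-congˡ (-‿cong (∧-neg φ (alt .swap [] y x) ds))) ⟨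
    φ x * F (y ∷ ds) + (- (φ y * F (x ∷ ds)) + - Fyx)
      ≈⟨ +-assoc _ _ _ ⟨
    φ x * F (y ∷ ds) + - (φ y * F (x ∷ ds)) + - Fyx
      ≈⟨ +-congʳ (+-comm _ _) ⟩
    - (φ y * F (x ∷ ds)) + φ x * F (y ∷ ds) + - Fyx
      ≈⟨ +-assoc _ _ _ ⟩
    - (φ y * F (x ∷ ds)) + (φ x * F (y ∷ ds) + - Fyx)
      ≈⟨ +-congˡ (-‿involutive _) ⟨
    - (φ y * F (x ∷ ds)) + - - (φ x * F (y ∷ ds) + - Fyx)
      ≈⟨ -‿+-comm _ _ ⟩
    - (φ y * F (x ∷ ds) + - (φ x * F (y ∷ ds) + - Fyx)) ∎
    where
    Fxy = (φ ∧ (λ es → F (x ∷ y ∷ es))) ds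
    Fyx = (φ ∧ (λ es → F (y ∷ x ∷ es))) ds
  ∧-alternating {F = F} φ alt .swap (c ∷ cs) x y ds = begin
    φ c * F (cs ++ x ∷ y ∷ ds) + - (φ ∧ (F ∘ (c ∷_))) (cs ++ x ∷ y ∷ ds)
      ≈⟨ +-cong (*-congˡ (alt .swap cs x y ds)) (-‿cong (∧-alternating φ (prefix alt c) .swap cs x y ds)) ⟩
    φ c * - F (cs ++ y ∷ x ∷ ds) + - - (φ ∧ (F ∘ (c ∷_))) (cs ++ y ∷ x ∷ ds)
      ≈⟨ +-congʳ (-‿distribʳ-* _ _) ⟨
    - (φ c * F (cs ++ y ∷ x ∷ ds)) + - - (φ ∧ (F ∘ (c ∷_))) (cs ++ y ∷ x ∷ ds)
      ≈⟨ -‿+-comm _ _ ⟩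
    - (φ c * F (cs ++ y ∷ x ∷ ds) + - (φ ∧ (F ∘ (c ∷_))) (cs ++ y ∷ x ∷ ds)) ∎
  ∧-alternating {F = F} φ alt .repeat [] x ds = begin
    φ x * F (x ∷ ds) + - (φ x * F (x ∷ ds) + - (φ ∧ (λ es → F (x ∷ x ∷ es))) ds)
      ≈⟨ +-congˡ (-‿cong (+-congˡ (trans (-‿cong (∧-zero φ (alt .repeat [] x) ds)) -0#≈0#))) ⟩
    φ x * F (x ∷ ds) + - (φ x * F (x ∷ ds) + 0#)
      ≈⟨ +-congˡ (-‿cong (+-identityʳ _)) ⟩
    φ x * F (x ∷ ds) + - (φ x * F (x ∷ ds))
      ≈⟨ -‿inverseʳ _ ⟩
    0# ∎
  ∧-alternating {F = F} φ alt .repeat (c ∷ cs) x ds = begin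
    φ c * F (cs ++ x ∷ x ∷ ds) + - (φ ∧ (F ∘ (c ∷_))) (cs ++ x ∷ x ∷ ds)
      ≈⟨ +-cong (*-congˡ (alt .repeat cs x ds)) (-‿cong (∧-alternating φ (prefix alt c) .repeat cs x ds)) ⟩
    φ c * 0# + - 0#
      ≈⟨ +-cong (zeroʳ _) -0#≈0# ⟩
    0# + 0#
      ≈⟨ +-identityˡ 0# ⟩
    0# ∎

  ⋀-alternating : ∀ {n} (φ : Vector (C → Carrier) n) → Alternating (⋀ φ)
  ⋀-alternating {n = zero}  φ .swap []      x y ds = sym -0#≈0#
  ⋀-alternating {n = zero}  φ .swap (_ ∷ _) x y ds = sym -0#≈0#
  ⋀-alternating {n = zero}  φ .repeat []      x ds = refl
  ⋀-alternating {n = zero}  φ .repeat (_ ∷ _) x ds = refl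
  ⋀-alternating {n = suc n} φ = ∧-alternating (φ zero) (⋀-alternating (φ ∘ suc))

  -- Adjacent swaps move `c` up to its second occurrence, each at the cost of a sign.
  repeat-head : Alternating F → ∀ {c ds} → c ∈ˡ ds → F (c ∷ ds) ≈ 0#
  repeat-head alt (here ≡.refl) = alt .repeat [] _ _
  repeat-head {F = F} alt {c} {x ∷ ds} (there c∈ds) = begin
    F (c ∷ x ∷ ds)   ≈⟨ alt .swap [] c x ds ⟩
    - F (x ∷ c ∷ ds) ≈⟨ -‿cong (repeat-head (prefix alt x) c∈ds) ⟩
    - 0#             ≈⟨ -0#≈0# ⟩
    0#               ∎

  repeat-after : Alternating F → ∀ cs {c ds} → c ∈ˡ ds → F (cs ++ c ∷ ds) ≈ 0#
  repeat-after alt []       = repeat-head alt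
  repeat-after alt (x ∷ cs) = repeat-after (prefix alt x) cs

  repeat-before : Alternating F → ∀ {c cs} ds → c ∈ˡ cs → F (cs ++ c ∷ ds) ≈ 0#
  repeat-before alt {cs = _ ∷ cs} ds (here ≡.refl)  = repeat-head alt (∈-++⁺ʳ cs (here ≡.refl))
  repeat-before alt {cs = x ∷ cs} ds (there c∈cs) = repeat-before (prefix alt x) ds c∈cs

  -- Each entry passed by the recursion of `_∧_` contributes one minus sign, which is one factor of
  -- the power of `- 1#`.
  ∧-Laplace : ∀ {n} (φ : C → Carrier) (F : Form C) (js : Vector C (suc n)) →
    (φ ∧ F) (toList js) ≈ sum (λ j → (- 1#) ^ toℕ j * (φ (js j) * F (toList (removeAt js j))))
  ∧-Laplace {n = zero} φ F js = begin
    φ (js zero) * F [] + - 0#            ≈⟨ +-congˡ -0#≈0# ⟩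
    φ (js zero) * F [] + 0#              ≈⟨ +-congʳ (*-identityˡ _) ⟨
    1# * (φ (js zero) * F []) + 0#       ∎
  ∧-Laplace {n = suc n} φ F js = +-cong (sym (*-identityˡ _)) (begin
    - (φ ∧ (F ∘ (js zero ∷_))) (toList (js ∘ suc))
      ≈⟨ -‿cong (∧-Laplace φ (F ∘ (js zero ∷_)) (js ∘ suc)) ⟩
    - sum (λ j → (- 1#) ^ toℕ j * minor j)
      ≈⟨ -1*x≈-x _ ⟨
    - 1# * sum (λ j → (- 1#) ^ toℕ j * minor j)
      ≈⟨ *-distribˡ-sum (- 1#) (λ j → (- 1#) ^ toℕ j * minor j) ⟩
    sum (λ j → - 1# * ((- 1#) ^ toℕ j * minor j))
      ≈⟨ sum-cong-≋ {suc n} {λ j → (- 1#) ^ suc (toℕ j) * minor j}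
           (λ j → *-assoc (- 1#) ((- 1#) ^ toℕ j) (minor j)) ⟨
    sum (λ j → (- 1#) ^ suc (toℕ j) * minor j) ∎)
    where
    minor : Vector Carrier (suc n)
    minor j = φ (js (suc j)) * F (js zero ∷ toList (removeAt (js ∘ suc) j))

  ⋀-det : ∀ {n} (φ : Vector (C → Carrier) n) (js : Vector C n) →
    ⋀ φ (toList js) ≈ det (λ i j → φ i (js j))
  ⋀-det {n = zero}  φ js = refl
  ⋀-det {n = suc n} φ js = trans (∧-Laplace (φ zero) (⋀ (φ ∘ suc)) js)
    (sum-cong-≋ {suc n} {λ j → (- 1#) ^ toℕ j * (φ zero (js j) * ⋀ (φ ∘ suc) (toList (removeAt js j)))}
      (λ j → *-congˡ {(- 1#) ^ toℕ j} (*-congˡ {φ zero (js j)} (⋀-det (φ ∘ suc) (removeAt js j)))))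

  module _ {k} (K : (C → Carrier) → Set k)
    (K-resp : ∀ {x y} → (∀ c → x c ≈ y c) → K x → K y)
    (K-0 : K (λ _ → 0#))
    (K-+ : ∀ {x y} → K x → K y → K (λ c → x c + y c))
    (K-* : ∀ a {x} → K x → K (λ c → a * x c))
    where

    private
      K-minus : ∀ {x y} → K x → K y → K (λ c → x c + - y c)
      K-minus Kx Ky = K-+ Kx (K-resp (λ _ → -1*x≈-x _) (K-* (- 1#) Ky))

    ∧-submodule-family : ∀ φ {G : C → Form C} → (∀ ds → K (λ c → G c ds)) → ∀ ds → K (λ c → (φ ∧ G c) ds)
    ∧-submodule-family φ KG []       = K-0
    ∧-submodule-family φ KG (d ∷ ds) =
      K-minus (K-* (φ d) (KG ds)) (∧-submodule-family φ (KG ∘ (d ∷_)) ds)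

    -- The free argument `c` is either consumed by `φ`, giving a multiple of `φ` itself, or handed
    -- on to `F` with a coefficient independent of `c`. Both kinds of term lie in `K`.
    ∧-submodule : ∀ {φ F} → K φ → (∀ cs ds → K (λ c → F (cs ++ c ∷ ds))) →
      ∀ cs ds → K (λ c → (φ ∧ F) (cs ++ c ∷ ds))
    ∧-submodule {φ} {F} Kφ KF [] ds =
      K-minus (K-resp (λ _ → *-comm _ _) (K-* (F ds) Kφ)) (∧-submodule-family φ (KF []) ds)
    ∧-submodule {φ} Kφ KF (x ∷ cs) ds =
      K-minus (K-* (φ x) (KF cs ds)) (∧-submodule Kφ (KF ∘ (x ∷_)) cs ds)

    ⋀-submodule : ∀ {n} (φ : Vector (C → Carrier) n) → (∀ i → K (φ i)) →
      ∀ cs ds → K (λ c → ⋀ φ (cs ++ c ∷ ds))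
    ⋀-submodule {n = zero}  φ Kφ []      ds = K-0
    ⋀-submodule {n = zero}  φ Kφ (_ ∷ _) ds = K-0
    ⋀-submodule {n = suc n} φ Kφ = ∧-submodule (Kφ zero) (⋀-submodule (φ ∘ suc) (Kφ ∘ suc))

  -- This plays the part of the adjugate identity. Replace column `j` by a free column index `c`: as
  -- a function of `c` the determinant is a combination of the rows of `N`, yet its value is `det N`
  -- at `c = j` and zero elsewhere, where a column is repeated.
  det-submodule : ∀ {n k} (K : Vector Carrier n → Set k) →
    (∀ {x y} → (∀ c → x c ≈ y c) → K x → K y) →
    K (λ _ → 0#) →
    (∀ {x y} → K x → K y → K (λ c → x c + y c)) →
    (∀ a {x} → K x → K (λ c → a * x c)) →
    (N : Matrix Carrier n n) → (∀ i → K (N i)) →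
    ∀ j {x} → x j ≈ det N → (∀ c → c ≢ j → x c ≈ 0#) → K x
  det-submodule {n} K K-resp K-0 K-+ K-* N KN j {x} xj≈det x≈0
    with cs , ds , split ← ∈-∃++ (∈-allFin j) =
      K-resp pointwise (⋀-submodule K K-resp K-0 K-+ K-* N KN cs ds)
    where
    pointwise : ∀ c → ⋀ N (cs ++ c ∷ ds) ≈ x c
    pointwise c with c Fin.≟ j
    ... | yes ≡.refl = begin
      ⋀ N (cs ++ c ∷ ds)    ≡⟨ ≡.cong (⋀ N) split ⟨
      ⋀ N (List.allFin n)   ≈⟨ ⋀-det N (λ i → i) ⟩
      det N                 ≈⟨ xj≈det ⟨
      x c                   ∎
    ... | no c≢j with ∈-++⁻ cs (≡.subst (c ∈ˡ_) split (∈-allFin c))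
    ...   | inj₁ c∈cs         = trans (repeat-before (⋀-alternating N) ds c∈cs) (sym (x≈0 c c≢j))
    ...   | inj₂ (here c≡j)   = contradiction c≡j c≢j
    ...   | inj₂ (there c∈ds) = trans (repeat-after (⋀-alternating N) cs c∈ds) (sym (x≈0 c c≢j))

-- Linear algebra over ℚ

open import Data.Rational.Base using (0ℚ; 1ℚ; _+_; _*_; -_; 1/_; ≢-nonZero; +-*-rawRing)
open import Data.Rational.Properties as ℚ using (+-*-commutativeRing)
open import Data.Rational.Solver using (module +-*-Solver)
open RawSemiringDefs (RawRing.rawSemiring +-*-rawRing) using (sum)
open SumProperties (CommutativeRing.semiring +-*-commutativeRing)
  using (sum-cong-≗; sum-replicate-zero; sum-remove; ∑-distrib-+; ∑-comm; *-distribˡ-sum; *-distribʳ-sum)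
open MatrixOps +-*-rawRing using (1ᴹ; _≈ᴹ_)
open Subspace using (Carrier)
open +-*-Solver using (solve; _:+_; _:*_; :-_; _:=_; con)
open ≡.≡-Reasoning

0ᵛ : ∀ {n} → Vector ℚ n
0ᵛ _ = 0ℚ

reciprocal : ∀ {a} → a ≢ 0ℚ → Σ[ b ∈ ℚ ] b * a ≡ 1ℚ
reciprocal {a} a≢0 = 1/ a , ℚ.*-inverseˡ a
  where instance _ = ≢-nonZero a≢0

*-cancelˡ-0 : ∀ {a} → a ≢ 0ℚ → ∀ {x} → a * x ≡ 0ℚ → x ≡ 0ℚ
*-cancelˡ-0 {a} a≢0 {x} ax≡0 with b , ba≡1 ← reciprocal a≢0 = begin
  x            ≡⟨ ℚ.*-identityˡ x ⟨
  1ℚ * x       ≡⟨ ≡.cong (_* x) ba≡1 ⟨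
  b * a * x    ≡⟨ ℚ.*-assoc b a x ⟩
  b * (a * x)  ≡⟨ ≡.cong (b *_) ax≡0 ⟩
  b * 0ℚ       ≡⟨ ℚ.*-zeroʳ b ⟩
  0ℚ           ∎

sum-zero : ∀ {n} {t : Vector ℚ n} → t ≗ 0ᵛ → sum t ≡ 0ℚ
sum-zero {n} t≗0 = ≡.trans (sum-cong-≗ t≗0) (sum-replicate-zero n)

sum-single : ∀ {n} (i : Fin n) (t : Vector ℚ n) → (∀ j → j ≢ i → t j ≡ 0ℚ) → sum t ≡ t i
sum-single {suc n} i t t≡0 = begin
  sum t                     ≡⟨ sum-remove {i = i} t ⟩
  t i + sum (removeAt t i)  ≡⟨ ≡.cong (t i +_) (sum-zero (λ j → t≡0 (punchIn i j) (Fin.punchInᵢ≢i i j))) ⟩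
  t i + 0ℚ                  ≡⟨ ℚ.+-identityʳ (t i) ⟩
  t i                       ∎

1ᴹ-diagonal : ∀ {n} (i : Fin n) → 1ᴹ i i ≡ 1ℚ
1ᴹ-diagonal i with i Fin.≟ i
... | yes _  = ≡.refl
... | no i≢i = contradiction ≡.refl i≢i

1ᴹ-offDiagonal : ∀ {n} {i j : Fin n} → i ≢ j → 1ᴹ i j ≡ 0ℚ
1ᴹ-offDiagonal {i = i} {j} i≢j with i Fin.≟ j
... | yes i≡j = contradiction i≡j i≢j
... | no _    = ≡.refl

linComb-congˡ : ∀ {k d} {c c′ : Vector ℚ k} (b : Vector (Vector ℚ d) k) → c ≗ c′ → linComb c b ≗ linComb c′ b
linComb-congˡ b c≗ i = sum-cong-≗ (λ j → ≡.cong (_* b j i) (c≗ j))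

linComb-congʳ : ∀ {k d} (c : Vector ℚ k) {b b′ : Vector (Vector ℚ d) k} →
  (∀ j → b j ≗ b′ j) → linComb c b ≗ linComb c b′
linComb-congʳ c b≗ i = sum-cong-≗ (λ j → ≡.cong (c j *_) (b≗ j i))

linComb-0 : ∀ {k d} (b : Vector (Vector ℚ d) k) → linComb 0ᵛ b ≗ 0ᵛ
linComb-0 b i = sum-zero (λ j → ℚ.*-zeroˡ (b j i))

linComb-+ : ∀ {k d} (c c′ : Vector ℚ k) (b : Vector (Vector ℚ d) k) i →
  linComb (λ j → c j + c′ j) b i ≡ linComb c b i + linComb c′ b i
linComb-+ c c′ b i = ≡.trans (sum-cong-≗ (λ j → ℚ.*-distribʳ-+ (b j i) (c j) (c′ j)))
  (∑-distrib-+ (λ j → c j * b j i) (λ j → c′ j * b j i))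

linComb-* : ∀ {k d} a (c : Vector ℚ k) (b : Vector (Vector ℚ d) k) i →
  linComb (λ j → a * c j) b i ≡ a * linComb c b i
linComb-* a c b i = ≡.trans (sum-cong-≗ (λ j → ℚ.*-assoc a (c j) (b j i)))
  (≡.sym (*-distribˡ-sum a (λ j → c j * b j i)))

linComb-linComb : ∀ {l k d} (c : Vector ℚ l) (M : Vector (Vector ℚ k) l) (b : Vector (Vector ℚ d) k) →
  linComb c (λ j → linComb (M j) b) ≗ linComb (linComb c M) b
linComb-linComb c M b i = begin
  sum (λ j → c j * sum (λ l → M j l * b l i))
    ≡⟨ sum-cong-≗ (λ j → *-distribˡ-sum (c j) (λ l → M j l * b l i)) ⟩
  sum (λ j → sum (λ l → c j * (M j l * b l i)))
    ≡⟨ ∑-comm (λ j l → c j * (M j l * b l i)) ⟩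
  sum (λ l → sum (λ j → c j * (M j l * b l i)))
    ≡⟨ sum-cong-≗ (λ l → sum-cong-≗ (λ j → ℚ.*-assoc (c j) (M j l) (b l i))) ⟨
  sum (λ l → sum (λ j → c j * M j l * b l i))
    ≡⟨ sum-cong-≗ (λ l → *-distribʳ-sum (b l i) (λ j → c j * M j l)) ⟨
  sum (λ l → sum (λ j → c j * M j l) * b l i) ∎

linComb-1ᴹ : ∀ {n} (c : Vector ℚ n) → linComb c 1ᴹ ≗ c
linComb-1ᴹ c i = begin
  linComb c 1ᴹ i  ≡⟨ sum-single i _ (λ j j≢i → ≡.trans (≡.cong (c j *_) (1ᴹ-offDiagonal j≢i)) (ℚ.*-zeroʳ (c j))) ⟩
  c i * 1ᴹ i i    ≡⟨ ≡.cong (c i *_) (1ᴹ-diagonal i) ⟩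
  c i * 1ℚ        ≡⟨ ℚ.*-identityʳ (c i) ⟩
  c i             ∎

linComb-unit : ∀ {k d} (j : Fin k) (b : Vector (Vector ℚ d) k) → linComb (λ l → 1ᴹ l j) b ≗ b j
linComb-unit j b i = begin
  linComb (λ l → 1ᴹ l j) b i
    ≡⟨ sum-single j _ (λ l l≢j → ≡.trans (≡.cong (_* b l i) (1ᴹ-offDiagonal l≢j)) (ℚ.*-zeroˡ (b l i))) ⟩
  1ᴹ j j * b j i  ≡⟨ ≡.cong (_* b j i) (1ᴹ-diagonal j) ⟩
  1ℚ * b j i      ≡⟨ ℚ.*-identityˡ (b j i) ⟩
  b j i           ∎

columns : ∀ {m n} → Matrix ℚ m n → Vector (Vector ℚ m) n
columns A j i = A i j

·ᵛ-linComb-columns : ∀ {m n} (A : Matrix ℚ m n) v → A ·ᵛ v ≗ linComb v (columns A)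
·ᵛ-linComb-columns A v i = sum-cong-≗ (λ j → ℚ.*-comm (A i j) (v j))

·ᵛ-cong : ∀ {m n} (A : Matrix ℚ m n) {u v} → u ≗ v → A ·ᵛ u ≗ A ·ᵛ v
·ᵛ-cong A u≗v i = sum-cong-≗ (λ j → ≡.cong (A i j *_) (u≗v j))

·ᵛ-linComb : ∀ {k m n} (A : Matrix ℚ m n) (c : Vector ℚ k) b → A ·ᵛ linComb c b ≗ linComb c (λ j → A ·ᵛ b j)
·ᵛ-linComb A c b i = begin
  (A ·ᵛ linComb c b) i                             ≡⟨ ·ᵛ-linComb-columns A (linComb c b) i ⟩
  linComb (linComb c b) (columns A) i              ≡⟨ linComb-linComb c b (columns A) i ⟨
  linComb c (λ j → linComb (b j) (columns A)) i    ≡⟨ linComb-congʳ c (λ j → ·ᵛ-linComb-columns A (b j)) i ⟨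
  linComb c (λ j → A ·ᵛ b j) i                     ∎

·ᵛ-0 : ∀ {m n} (A : Matrix ℚ m n) → A ·ᵛ 0ᵛ ≗ 0ᵛ
·ᵛ-0 A i = sum-zero (λ j → ℚ.*-zeroʳ (A i j))

·ᵛ-+ : ∀ {m n} (A : Matrix ℚ m n) u v i → (A ·ᵛ (λ j → u j + v j)) i ≡ (A ·ᵛ u) i + (A ·ᵛ v) i
·ᵛ-+ A u v i = ≡.trans (sum-cong-≗ (λ j → ℚ.*-distribˡ-+ (A i j) (u j) (v j)))
  (∑-distrib-+ (λ j → A i j * u j) (λ j → A i j * v j))

·ᵛ-* : ∀ {m n} (A : Matrix ℚ m n) a v i → (A ·ᵛ (λ j → a * v j)) i ≡ a * (A ·ᵛ v) i
·ᵛ-* A a v i = ≡.trans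
  (sum-cong-≗ (λ j → solve 3 (λ x y z → x :* (y :* z) := y :* (x :* z)) ≡.refl (A i j) a (v j)))
  (≡.sym (*-distribˡ-sum a (λ j → A i j * v j)))

*ᴹ-·ᵛ : ∀ {l m n} (A : Matrix ℚ l m) (B : Matrix ℚ m n) v → (A *ᴹ B) ·ᵛ v ≗ A ·ᵛ (B ·ᵛ v)
*ᴹ-·ᵛ A B v i = begin
  -- `v` is read as a family of vectors of length 1, which makes associativity an instance of
  -- `linComb-linComb`.
  sum (λ k → sum (λ j → A i j * B j k) * v k)    ≡⟨ linComb-linComb (A i) B (λ k (_ : Fin 1) → v k) zero ⟨
  sum (λ j → A i j * sum (λ k → B j k * v k))    ∎

1ᴹ-·ᵛ : ∀ {n} (v : Vector ℚ n) → 1ᴹ ·ᵛ v ≗ v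
1ᴹ-·ᵛ v i = begin
  (1ᴹ ·ᵛ v) i     ≡⟨ sum-single i _ (λ j j≢i → ≡.trans (≡.cong (_* v j) (1ᴹ-offDiagonal (j≢i ∘ ≡.sym))) (ℚ.*-zeroˡ (v j))) ⟩
  1ᴹ i i * v i    ≡⟨ ≡.cong (_* v i) (1ᴹ-diagonal i) ⟩
  1ℚ * v i        ≡⟨ ℚ.*-identityˡ (v i) ⟩
  v i             ∎

inverse-·ᵛ : ∀ {n} (A B : Matrix ℚ n n) → B *ᴹ A ≈ᴹ 1ᴹ → ∀ v → B ·ᵛ (A ·ᵛ v) ≗ v
inverse-·ᵛ A B BA≈1 v i = begin
  (B ·ᵛ (A ·ᵛ v)) i   ≡⟨ *ᴹ-·ᵛ B A v i ⟨
  ((B *ᴹ A) ·ᵛ v) i   ≡⟨ sum-cong-≗ (λ j → ≡.cong (_* v j) (BA≈1 i j)) ⟩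
  (1ᴹ ·ᵛ v) i         ≡⟨ 1ᴹ-·ᵛ v i ⟩
  v i                 ∎

-- Linear dependence and Gaussian elimination.

Independent : ∀ {k d} → Vector (Vector ℚ d) k → Set
Independent b = ∀ c → linComb c b ≗ 0ᵛ → c ≗ 0ᵛ

Dependent : ∀ {k d} → Vector (Vector ℚ d) k → Set
Dependent {k} b = Σ[ c ∈ Vector ℚ k ] ¬ c ≗ 0ᵛ × linComb c b ≗ 0ᵛ

-- Gaussian elimination: a nonzero coordinate p of the first vector is used to clear
-- that coordinate in the others, and is then deleted.
module Elimination {k d} (b : Vector (Vector ℚ (suc d)) (suc k)) (p : Fin (suc d))
  (t : ℚ) (tb≡1 : t * b zero p ≡ 1ℚ) where

  reduced : Vector (Vector ℚ d) k
  reduced j i = b (suc j) (punchIn p i) + - (t * b zero (punchIn p i)) * b (suc j) p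

  rest : Vector ℚ k → Vector ℚ (suc d)
  rest c = linComb c (b ∘ suc)

  linComb-reduced : ∀ c i →
    linComb c reduced i ≡ rest c (punchIn p i) + - (t * b zero (punchIn p i)) * rest c p
  linComb-reduced c i = begin
    sum (λ j → c j * (b (suc j) (punchIn p i) + s * b (suc j) p))
      ≡⟨ sum-cong-≗ (λ j → solve 4 (λ c x s y → c :* (x :+ s :* y) := c :* x :+ s :* (c :* y)) ≡.refl
           (c j) (b (suc j) (punchIn p i)) s (b (suc j) p)) ⟩
    sum (λ j → c j * b (suc j) (punchIn p i) + s * (c j * b (suc j) p))
      ≡⟨ ∑-distrib-+ (λ j → c j * b (suc j) (punchIn p i)) (λ j → s * (c j * b (suc j) p)) ⟩
    rest c (punchIn p i) + sum (λ j → s * (c j * b (suc j) p))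
      ≡⟨ ≡.cong (rest c (punchIn p i) +_) (*-distribˡ-sum s (λ j → c j * b (suc j) p)) ⟨
    rest c (punchIn p i) + s * rest c p ∎
    where s = - (t * b zero (punchIn p i))

  -- The coefficient given to `b zero` is the one that cancels coordinate `p`; with it, the other
  -- coordinates become those of the relation among `reduced`.
  extend : Dependent reduced → Dependent b
  extend (c , c≢0 , c·b≗0) = (- (t * rest c p)) ∷ᵛ c , (λ x≗0 → c≢0 (x≗0 ∘ suc)) , vanish
    where
    vanish : linComb ((- (t * rest c p)) ∷ᵛ c) b ≗ 0ᵛ
    vanish i with p Fin.≟ i
    ... | yes ≡.refl = begin
      - (t * rest c p) * b zero p + rest c p
        ≡⟨ solve 3 (λ t r a → (:- (t :* r)) :* a :+ r := (:- r) :* (t :* a) :+ r) ≡.refl t (rest c p) (b zero p) ⟩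
      - rest c p * (t * b zero p) + rest c p
        ≡⟨ ≡.cong (λ u → - rest c p * u + rest c p) tb≡1 ⟩
      - rest c p * 1ℚ + rest c p
        ≡⟨ solve 1 (λ r → (:- r) :* con 1ℚ :+ r := con 0ℚ) ≡.refl (rest c p) ⟩
      0ℚ ∎
    ... | no p≢i = begin
      - (t * rest c p) * b zero i + rest c i
        ≡⟨ solve 4 (λ t r a s → (:- (t :* r)) :* a :+ s := s :+ (:- (t :* a)) :* r) ≡.refl t (rest c p) (b zero i) (rest c i) ⟩
      rest c i + - (t * b zero i) * rest c p
        ≡⟨ ≡.cong (λ i → rest c i + - (t * b zero i) * rest c p) (Fin.punchIn-punchOut p≢i) ⟨
      rest c i′ + - (t * b zero i′) * rest c p
        ≡⟨ linComb-reduced c (punchOut p≢i) ⟨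
      linComb c reduced (punchOut p≢i)
        ≡⟨ c·b≗0 (punchOut p≢i) ⟩
      0ℚ ∎
      where i′ = punchIn p (punchOut p≢i)

  -- Coordinate `p` of a relation expresses the coefficient of `b zero` through the others.
  -- Substituting it turns the remaining coordinates into a relation among `reduced`.
  lift-independent : Independent reduced → Independent b
  lift-independent indep x x·b≗0 = λ where
      zero    → x₀≡0
      (suc j) → c≗0 j
    where
    c  = x ∘ suc
    x₀ = x zero

    x₀≡ : x₀ ≡ - (t * rest c p)
    x₀≡ = begin
      x₀                                              ≡⟨ solve 1 (λ x → x := x :* con 1ℚ) ≡.refl x₀ ⟩
      x₀ * 1ℚ                                         ≡⟨ ≡.cong (x₀ *_) tb≡1 ⟨
      x₀ * (t * b zero p)
        ≡⟨ solve 4 (λ x t a r → x :* (t :* a) := t :* (x :* a :+ r) :+ (:- (t :* r))) ≡.refl x₀ t (b zero p) (rest c p) ⟩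
      t * (x₀ * b zero p + rest c p) + - (t * rest c p)
        ≡⟨ ≡.cong (λ u → t * u + - (t * rest c p)) (x·b≗0 p) ⟩
      t * 0ℚ + - (t * rest c p)
        ≡⟨ solve 2 (λ t r → t :* con 0ℚ :+ (:- (t :* r)) := :- (t :* r)) ≡.refl t (rest c p) ⟩
      - (t * rest c p)                                ∎

    c≗0 : c ≗ 0ᵛ
    c≗0 = indep c (λ i → begin
      linComb c reduced i
        ≡⟨ linComb-reduced c i ⟩
      rest c (punchIn p i) + - (t * b zero (punchIn p i)) * rest c p
        ≡⟨ solve 4 (λ t r a s → s :+ (:- (t :* a)) :* r := (:- (t :* r)) :* a :+ s) ≡.refl t (rest c p) (b zero (punchIn p i)) (rest c (punchIn p i)) ⟩
      - (t * rest c p) * b zero (punchIn p i) + rest c (punchIn p i)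
        ≡⟨ ≡.cong (λ u → u * b zero (punchIn p i) + rest c (punchIn p i)) x₀≡ ⟨
      x₀ * b zero (punchIn p i) + rest c (punchIn p i)
        ≡⟨ x·b≗0 (punchIn p i) ⟩
      0ℚ ∎)

    x₀≡0 : x₀ ≡ 0ℚ
    x₀≡0 = begin
      x₀               ≡⟨ x₀≡ ⟩
      - (t * rest c p) ≡⟨ ≡.cong (λ r → - (t * r)) (≡.trans (linComb-congˡ (b ∘ suc) c≗0 p) (linComb-0 (b ∘ suc) p)) ⟩
      - (t * 0ℚ)       ≡⟨ solve 1 (λ t → :- (t :* con 0ℚ) := con 0ℚ) ≡.refl t ⟩
      0ℚ               ∎

-- Each elimination step uses up one vector and one coordinate, so the decision and the bound
-- `k ≤ d` come out of the same recursion.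
dependent⊎independent : ∀ {k d} (b : Vector (Vector ℚ d) k) → Dependent b ⊎ (Independent b × k ≤ d)
dependent⊎independent {zero}  b = inj₂ ((λ c _ ()) , z≤n)
dependent⊎independent {suc k} {d} b with Fin.any? (λ i → ¬? (b zero i ℚ.≟ 0ℚ))
... | no b₀≡0 = inj₁ (1ℚ ∷ᵛ 0ᵛ , (λ 1≡0 → contradiction (1≡0 zero) λ ()) , vanish)
  where
  vanish : linComb (1ℚ ∷ᵛ 0ᵛ) b ≗ 0ᵛ
  vanish i with b zero i ℚ.≟ 0ℚ
  ... | yes b₀i≡0 = ≡.cong₂ _+_ (≡.trans (ℚ.*-identityˡ _) b₀i≡0) (linComb-0 (b ∘ suc) i)
  ... | no b₀i≢0  = contradiction (i , b₀i≢0) b₀≡0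
dependent⊎independent {suc k} {suc d} b | yes (p , b₀p≢0) with reciprocal b₀p≢0
... | t , tb≡1 with dependent⊎independent (Elimination.reduced b p t tb≡1)
...   | inj₁ dep           = inj₁ (Elimination.extend b p t tb≡1 dep)
...   | inj₂ (indep , k≤d) = inj₂ (Elimination.lift-independent b p t tb≡1 indep , s≤s k≤d)

dependent-> : ∀ {k d} (b : Vector (Vector ℚ d) k) → d < k → Dependent b
dependent-> b d<k with dependent⊎independent b
... | inj₁ dep       = dep
... | inj₂ (_ , k≤d) = contradiction k≤d (ℕ.<⇒≱ d<k)

-- Steinitz: the coefficient rows of the `v j` are `l` vectors of length `k < l`, and a relation
-- among these rows is one among the `v j`.
dependent-in-span : ∀ {l k d} (v : Vector (Vector ℚ d) l) (b : Vector (Vector ℚ d) k) →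
  (∀ j → ∃[ c ] v j ≗ linComb c b) → k < l → Dependent v
dependent-in-span v b v∈b k<l with dependent-> (proj₁ ∘ v∈b) k<l
... | c , c≢0 , cM≗0 = c , c≢0 , λ i → begin
  linComb c v i
    ≡⟨ linComb-congʳ c (proj₂ ∘ v∈b) i ⟩
  linComb c (λ j → linComb (proj₁ (v∈b j)) b) i
    ≡⟨ linComb-linComb c (proj₁ ∘ v∈b) b i ⟩
  linComb (linComb c (proj₁ ∘ v∈b)) b i
    ≡⟨ linComb-congˡ b cM≗0 i ⟩
  linComb 0ᵛ b i
    ≡⟨ linComb-0 b i ⟩
  0ℚ ∎

-- The coefficient of `v` is nonzero, for otherwise the relation would live inside `b`; dividing by
-- it solves for `v`.
independent-∷⇒span : ∀ {k d} (b : Vector (Vector ℚ d) k) → Independent b →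
  ∀ v → Dependent (v ∷ᵛ b) → ∃[ c ] v ≗ linComb c b
independent-∷⇒span b indep v (c , c≢0 , c·vb≗0) with c zero ℚ.≟ 0ℚ
... | yes c₀≡0 = contradiction c≗0 c≢0
  where
  tail≗0 : c ∘ suc ≗ 0ᵛ
  tail≗0 = indep (c ∘ suc) (λ i → begin
    linComb (c ∘ suc) b i                   ≡⟨ solve 2 (λ y x → y := con 0ℚ :* x :+ y) ≡.refl (linComb (c ∘ suc) b i) (v i) ⟩
    0ℚ * v i + linComb (c ∘ suc) b i        ≡⟨ ≡.cong (λ u → u * v i + linComb (c ∘ suc) b i) c₀≡0 ⟨
    c zero * v i + linComb (c ∘ suc) b i    ≡⟨ c·vb≗0 i ⟩
    0ℚ                                      ∎)
  c≗0 : c ≗ 0ᵛ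
  c≗0 zero    = c₀≡0
  c≗0 (suc j) = tail≗0 j
... | no c₀≢0 with t , tc≡1 ← reciprocal c₀≢0 = (λ j → - t * c (suc j)) , λ i → begin
  v i                                           ≡⟨ ℚ.*-identityˡ (v i) ⟨
  1ℚ * v i                                      ≡⟨ ≡.cong (_* v i) tc≡1 ⟨
  t * c zero * v i
    ≡⟨ solve 4 (λ t c v r → t :* c :* v := t :* (c :* v :+ r) :+ (:- t) :* r) ≡.refl t (c zero) (v i) (linComb (c ∘ suc) b i) ⟩
  t * (c zero * v i + linComb (c ∘ suc) b i) + - t * linComb (c ∘ suc) b i
    ≡⟨ ≡.cong (λ u → t * u + - t * linComb (c ∘ suc) b i) (c·vb≗0 i) ⟩
  t * 0ℚ + - t * linComb (c ∘ suc) b i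
    ≡⟨ solve 2 (λ t r → t :* con 0ℚ :+ (:- t) :* r := (:- t) :* r) ≡.refl t (linComb (c ∘ suc) b i) ⟩
  - t * linComb (c ∘ suc) b i                   ≡⟨ linComb-* (- t) (c ∘ suc) b i ⟨
  linComb (λ j → - t * c (suc j)) b i           ∎

independent⇒injective : ∀ {k d} (b : Vector (Vector ℚ d) k) → Independent b →
  ∀ {c c′} → linComb c b ≗ linComb c′ b → c ≗ c′
independent⇒injective b indep {c} {c′} eq j = begin
  c j                               ≡⟨ solve 2 (λ x y → x := (x :+ con (- 1ℚ) :* y) :+ y) ≡.refl (c j) (c′ j) ⟩
  (c j + - 1ℚ * c′ j) + c′ j        ≡⟨ ≡.cong (_+ c′ j) (indep (λ j → c j + - 1ℚ * c′ j) difference≗0 j) ⟩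
  0ℚ + c′ j                         ≡⟨ ℚ.+-identityˡ (c′ j) ⟩
  c′ j                              ∎
  where
  difference≗0 : linComb (λ j → c j + - 1ℚ * c′ j) b ≗ 0ᵛ
  difference≗0 i = begin
    linComb (λ j → c j + - 1ℚ * c′ j) b i            ≡⟨ linComb-+ c (λ j → - 1ℚ * c′ j) b i ⟩
    linComb c b i + linComb (λ j → - 1ℚ * c′ j) b i  ≡⟨ ≡.cong₂ _+_ (eq i) (linComb-* (- 1ℚ) c′ b i) ⟩
    linComb c′ b i + - 1ℚ * linComb c′ b i           ≡⟨ solve 1 (λ x → x :+ con (- 1ℚ) :* x := con 0ℚ) ≡.refl (linComb c′ b i) ⟩
    0ℚ                                               ∎

-- A standard vector and the `n` columns are `n + 1` vectors of length `n`, so the standard vector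
-- is a combination of columns; these combinations form a right inverse `B`. It is also a left
-- inverse, since `A(BA) = A` and `A` is injective on coefficient vectors.
independent⇒invertible : ∀ {n} (A : Matrix ℚ n n) → Independent (columns A) → Invertible A
independent⇒invertible {n} A indep = record
  { inverse  = λ j i → proj₁ (solution i) j
  ; inverseʳ = λ r i → ≡.trans (sum-cong-≗ (λ j → ℚ.*-comm (A r j) (proj₁ (solution i) j))) (≡.sym (proj₂ (solution i) r))
  ; inverseˡ = λ j l → ≡.trans (sum-cong-≗ (λ m → ℚ.*-comm (proj₁ (solution m) j) (A m l)))
      (independent⇒injective (columns A) indep {linComb (columns A l) (proj₁ ∘ solution)} {λ j → 1ᴹ j l} (λ r → begin
      linComb (linComb (columns A l) (proj₁ ∘ solution)) (columns A) r
        ≡⟨ linComb-linComb (columns A l) (proj₁ ∘ solution) (columns A) r ⟨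
      linComb (columns A l) (λ m → linComb (proj₁ (solution m)) (columns A)) r
        ≡⟨ linComb-congʳ (columns A l) (proj₂ ∘ solution) r ⟨
      linComb (columns A l) (λ m r → 1ᴹ r m) r
        ≡⟨ sum-cong-≗ (λ m → ℚ.*-comm (A m l) (1ᴹ r m)) ⟩
      (1ᴹ ·ᵛ columns A l) r
        ≡⟨ 1ᴹ-·ᵛ (columns A l) r ⟩
      A r l
        ≡⟨ linComb-unit l (columns A) r ⟨
      linComb (λ j → 1ᴹ j l) (columns A) r ∎) j)
    }
  where
  solution : ∀ i → ∃[ c ] (λ r → 1ᴹ r i) ≗ linComb c (columns A)
  solution i = independent-∷⇒span (columns A) indep _ (dependent-> (_ ∷ᵛ columns A) (ℕ.n<1+n n))

-- Spans and non-trivial subspaces.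

Span : ∀ {k d} → Vector (Vector ℚ d) k → Subspace d
Span b = record
  { Carrier  = λ u → ∃[ c ] u ≗ linComb c b
  ; resp     = λ u≗v (c , u≗) → c , λ i → ≡.trans (≡.sym (u≗v i)) (u≗ i)
  ; 0-closed = 0ᵛ , λ i → ≡.sym (linComb-0 b i)
  ; +-closed = λ (c , u≗) (c′ , v≗) → (λ j → c j + c′ j) ,
      λ i → ≡.trans (≡.cong₂ _+_ (u≗ i) (v≗ i)) (≡.sym (linComb-+ c c′ b i))
  ; ·-closed = λ a (c , u≗) → (λ j → a * c j) ,
      λ i → ≡.trans (≡.cong (a *_) (u≗ i)) (≡.sym (linComb-* a c b i))
  }

Span-member : ∀ {k d} (b : Vector (Vector ℚ d) k) j → b j ∈ Carrier (Span b)
Span-member b j = (λ l → 1ᴹ l j) , λ i → ≡.sym (linComb-unit j b i)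

Span-basis : ∀ {k d} (b : Vector (Vector ℚ d) k) → Independent b → IsBasis (Span b) b
Span-basis b indep = record
  { member      = Span-member b
  ; spanning    = λ u∈ → u∈
  ; independent = indep
  }

independent⇒nonzero : ∀ {k d} (b : Vector (Vector ℚ d) k) → Independent b → ∀ j → ¬ b j ≗ 0ᵛ
independent⇒nonzero b indep j bj≗0 =
  contradiction (≡.trans (≡.sym (1ᴹ-diagonal j)) (indep (λ l → 1ᴹ l j) (λ i → ≡.trans (linComb-unit j b i) (bj≗0 i)) j)) λ ()

spanning⇒≮ : ∀ {k d} (b : Vector (Vector ℚ d) k) → (∀ u → ∃[ c ] u ≗ linComb c b) → ¬ k < d
spanning⇒≮ b span k<d with dependent-in-span 1ᴹ b (λ j → span (1ᴹ j)) k<d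
... | c , c≢0 , c·1≗0 = c≢0 (λ i → ≡.trans (≡.sym (linComb-1ᴹ c i)) (c·1≗0 i))

Span-nontrivial : ∀ {k d} (b : Vector (Vector ℚ d) (suc k)) → Independent b → suc k < d → NonTrivial (Span b)
Span-nontrivial b indep k<d =
  (λ zero → independent⇒nonzero b indep Fin.zero (zero (b Fin.zero) (Span-member b Fin.zero))) ,
  (λ all → spanning⇒≮ b all k<d)

independent-·ᵛ : ∀ {k m n} (A : Matrix ℚ m n) (b : Vector (Vector ℚ n) k) →
  (∀ v → A ·ᵛ v ≗ 0ᵛ → v ≗ 0ᵛ) → Independent b → Independent (λ j → A ·ᵛ b j)
independent-·ᵛ A b injective indep c c·Ab≗0 =
  indep c (injective (linComb c b) (λ i → ≡.trans (·ᵛ-linComb A c b i) (c·Ab≗0 i)))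

nonzero⇒independent : ∀ {d} (v : Vector ℚ d) → ¬ v ≗ 0ᵛ → Independent {1} (λ _ → v)
nonzero⇒independent v v≢0 c cv≗0 zero with c zero ℚ.≟ 0ℚ
... | yes c₀≡0 = c₀≡0
... | no c₀≢0  = contradiction (λ i → *-cancelˡ-0 c₀≢0 (≡.trans (≡.sym (ℚ.+-identityʳ _)) (cv≗0 i))) v≢0

-- Polynomials and their degrees

open RawSemiringDefs (RawRing.rawSemiring ℚ[X])
  using (_∣_; mkIrred; module Irreducible) renaming (sum to sumᴾ; _^_ to _^ᴾ_)
open MatrixOps ℚ[X] using () renaming (det to detᴾ; 1ᴹ to 1ᴾ)

coeff-+ : ∀ p q n → coeff (p +ᴾ q) n ≡ coeff p n + coeff q n
coeff-+ []      q       n       = ≡.sym (ℚ.+-identityˡ _)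
coeff-+ (a ∷ p) []      n       = ≡.sym (ℚ.+-identityʳ _)
coeff-+ (a ∷ p) (b ∷ q) zero    = ≡.refl
coeff-+ (a ∷ p) (b ∷ q) (suc n) = coeff-+ p q n

coeff-scale : ∀ a p n → coeff (List.map (a *_) p) n ≡ a * coeff p n
coeff-scale a []      n       = ≡.sym (ℚ.*-zeroʳ a)
coeff-scale a (b ∷ p) zero    = ≡.refl
coeff-scale a (b ∷ p) (suc n) = coeff-scale a p n

coeff-*-∷ : ∀ a p q n → coeff ((a ∷ p) *ᴾ q) n ≡ a * coeff q n + coeff (0ℚ ∷ (p *ᴾ q)) n
coeff-*-∷ a p q n = ≡.trans (coeff-+ (List.map (a *_) q) _ n) (≡.cong (_+ _) (coeff-scale a q n))

coeff-toList : ∀ {m} (c : Vector ℚ m) j → coeff (toList c) (toℕ j) ≡ c j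
coeff-toList c zero    = ≡.refl
coeff-toList c (suc j) = coeff-toList (c ∘ suc) j

Unit : Poly → Set
Unit x = x ∣ constᴾ 1ℚ

-- A bound on coefficients instead of list length, so that trailing zeros do no harm.
-- `DegreeBelow 0` singles out the zero polynomial.
DegreeBelow : ℕ → Poly → Set
DegreeBelow n p = ∀ k → n ≤ k → coeff p k ≡ 0ℚ

-- `a` may be zero, which lets leading terms multiply without side conditions; `n` is the degree
-- only in company with `a ≢ 0ℚ`.
record LeadingTerm (n : ℕ) (a : ℚ) (p : Poly) : Set where
  constructor leading
  field
    coefficient : coeff p n ≡ a
    above       : DegreeBelow (suc n) p
open LeadingTerm

degreeBelow-mono : ∀ {m n p} → m ≤ n → DegreeBelow m p → DegreeBelow n p
degreeBelow-mono m≤n below k n≤k = below k (ℕ.≤-trans m≤n n≤k)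

degreeBelow-+ : ∀ {n} p q → DegreeBelow n p → DegreeBelow n q → DegreeBelow n (p +ᴾ q)
degreeBelow-+ p q p< q< k n≤k = ≡.trans (coeff-+ p q k) (≡.cong₂ _+_ (p< k n≤k) (q< k n≤k))

degreeBelow-const : ∀ a → DegreeBelow 1 (constᴾ a)
degreeBelow-const a (suc k) _ = ≡.refl

degreeBelow-toList : ∀ {m} (c : Vector ℚ m) → DegreeBelow m (toList c)
degreeBelow-toList {zero}  c k       _         = ≡.refl
degreeBelow-toList {suc m} c (suc k) (s≤s m≤k) = degreeBelow-toList (c ∘ suc) k m≤k

zero-shift : ∀ {p} → DegreeBelow 0 p → DegreeBelow 0 (0ℚ ∷ p)
zero-shift p≈0 zero    _ = ≡.refl
zero-shift p≈0 (suc k) _ = p≈0 k z≤n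

zero-* : ∀ p q → DegreeBelow 0 p → DegreeBelow 0 (p *ᴾ q)
zero-* []      q p≈0 k _ = ≡.refl
zero-* (a ∷ p) q p≈0 k _ = begin
  coeff ((a ∷ p) *ᴾ q) k                      ≡⟨ coeff-*-∷ a p q k ⟩
  a * coeff q k + coeff (0ℚ ∷ (p *ᴾ q)) k
    ≡⟨ ≡.cong₂ _+_ (≡.cong (_* coeff q k) (p≈0 0 z≤n)) (zero-shift (zero-* p q (λ k _ → p≈0 (suc k) z≤n)) k z≤n) ⟩
  0ℚ * coeff q k + 0ℚ                         ≡⟨ solve 1 (λ x → con 0ℚ :* x :+ con 0ℚ := con 0ℚ) ≡.refl (coeff q k) ⟩
  0ℚ                                          ∎

*-zero : ∀ p q → DegreeBelow 0 q → DegreeBelow 0 (p *ᴾ q)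
*-zero []      q q≈0 k _ = ≡.refl
*-zero (a ∷ p) q q≈0 k _ = begin
  coeff ((a ∷ p) *ᴾ q) k                      ≡⟨ coeff-*-∷ a p q k ⟩
  a * coeff q k + coeff (0ℚ ∷ (p *ᴾ q)) k     ≡⟨ ≡.cong₂ (λ x y → a * x + y) (q≈0 k z≤n) (zero-shift (*-zero p q q≈0) k z≤n) ⟩
  a * 0ℚ + 0ℚ                                 ≡⟨ solve 1 (λ x → x :* con 0ℚ :+ con 0ℚ := con 0ℚ) ≡.refl a ⟩
  0ℚ                                          ∎

-- The second bound is written as a successor so that the bound on the product needs no truncated
-- subtraction; `m = 0` is the case of a zero factor.
degreeBelow-* : ∀ {m n} p q → DegreeBelow m p → DegreeBelow (suc n) q → DegreeBelow (m ℕ.+ n) (p *ᴾ q)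
degreeBelow-* {zero} p q p< q< k _ = zero-* p q p< k z≤n
degreeBelow-* {suc m} [] q p< q< k _ = ≡.refl
degreeBelow-* {suc m} {n} (a ∷ p) q p< q< (suc k) (s≤s m+n≤k) = begin
  coeff ((a ∷ p) *ᴾ q) (suc k)                ≡⟨ coeff-*-∷ a p q (suc k) ⟩
  a * coeff q (suc k) + coeff (p *ᴾ q) k
    ≡⟨ ≡.cong₂ (λ x y → a * x + y) (q< (suc k) (s≤s (ℕ.≤-trans (ℕ.m≤n+m n m) m+n≤k)))
         (degreeBelow-* p q (λ k m≤k → p< (suc k) (s≤s m≤k)) q< k m+n≤k) ⟩
  a * 0ℚ + 0ℚ                                 ≡⟨ solve 1 (λ x → x :* con 0ℚ :+ con 0ℚ := con 0ℚ) ≡.refl a ⟩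
  0ℚ                                          ∎

coeff-*-leading : ∀ {m n a b} p q → LeadingTerm m a p → LeadingTerm n b q → coeff (p *ᴾ q) (m ℕ.+ n) ≡ a * b
coeff-*-leading {b = b} [] q (leading ≡.refl _) _ = ≡.sym (ℚ.*-zeroˡ b)
coeff-*-leading {zero} {n} {a} {b} (a ∷ p) q (leading ≡.refl p<) (leading ≡.refl q<) = begin
  coeff ((a ∷ p) *ᴾ q) n                      ≡⟨ coeff-*-∷ a p q n ⟩
  a * coeff q n + coeff (0ℚ ∷ (p *ᴾ q)) n
    ≡⟨ ≡.cong (a * coeff q n +_) (zero-shift (zero-* p q (λ k _ → p< (suc k) (s≤s z≤n))) n z≤n) ⟩
  a * coeff q n + 0ℚ                          ≡⟨ ℚ.+-identityʳ _ ⟩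
  a * coeff q n                               ∎
coeff-*-leading {suc m} {n} {a} {b} (c ∷ p) q (leading eq p<) q↓ = begin
  coeff ((c ∷ p) *ᴾ q) (suc (m ℕ.+ n))        ≡⟨ coeff-*-∷ c p q _ ⟩
  c * coeff q (suc (m ℕ.+ n)) + coeff (p *ᴾ q) (m ℕ.+ n)
    ≡⟨ ≡.cong₂ (λ x y → c * x + y) (above q↓ _ (s≤s (ℕ.m≤n+m n m)))
         (coeff-*-leading p q (leading eq (λ k m<k → p< (suc k) (s≤s m<k))) q↓) ⟩
  c * 0ℚ + a * b                              ≡⟨ solve 2 (λ x y → x :* con 0ℚ :+ y := y) ≡.refl c (a * b) ⟩
  a * b                                       ∎

leadingTerm-* : ∀ {m n a b} p q → LeadingTerm m a p → LeadingTerm n b q → LeadingTerm (m ℕ.+ n) (a * b) (p *ᴾ q)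
leadingTerm-* p q p↓ q↓ = leading (coeff-*-leading p q p↓ q↓) (degreeBelow-* p q (above p↓) (above q↓))

leadingTerm-+ : ∀ {n a} p q → LeadingTerm n a p → DegreeBelow n q → LeadingTerm n a (p +ᴾ q)
leadingTerm-+ {n} {a} p q p↓ q< = leading
  (begin
    coeff (p +ᴾ q) n       ≡⟨ coeff-+ p q n ⟩
    coeff p n + coeff q n  ≡⟨ ≡.cong₂ _+_ (coefficient p↓) (q< n ℕ.≤-refl) ⟩
    a + 0ℚ                 ≡⟨ ℚ.+-identityʳ a ⟩
    a                      ∎)
  (degreeBelow-+ p q (above p↓) (degreeBelow-mono {p = q} (ℕ.n≤1+n n) q<))

leadingTerm-resp : ∀ {n a p q} → p ≈ᴾ q → LeadingTerm n a p → LeadingTerm n a q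
leadingTerm-resp p≈q (leading eq p<) =
  leading (≡.trans (≡.sym (p≈q _)) eq) (λ k n<k → ≡.trans (≡.sym (p≈q k)) (p< k n<k))

zero⊎leadingTerm : ∀ p → DegreeBelow 0 p ⊎ (∃[ n ] ∃[ a ] a ≢ 0ℚ × LeadingTerm n a p)
zero⊎leadingTerm [] = inj₁ (λ _ _ → ≡.refl)
zero⊎leadingTerm (c ∷ p) with zero⊎leadingTerm p
... | inj₂ (n , a , a≢0 , leading eq p<) = inj₂ (suc n , a , a≢0 , leading eq λ { (suc k) (s≤s n<k) → p< k n<k })
... | inj₁ p≈0 with c ℚ.≟ 0ℚ
...   | yes c≡0 = inj₁ λ { zero _ → c≡0 ; (suc k) _ → p≈0 k z≤n }
...   | no c≢0  = inj₂ (0 , c , c≢0 , leading ≡.refl λ { (suc k) _ → p≈0 k z≤n })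

leadingTerm-< : ∀ {m n a p} → a ≢ 0ℚ → LeadingTerm n a p → DegreeBelow m p → n < m
leadingTerm-< {m} {n} a≢0 p↓ p< with n ℕ.<? m
... | yes n<m = n<m
... | no n≮m  = contradiction (≡.trans (≡.sym (coefficient p↓)) (p< n (ℕ.≮⇒≥ n≮m))) a≢0

degree-unique : ∀ {m n a b p} → a ≢ 0ℚ → b ≢ 0ℚ → LeadingTerm m a p → LeadingTerm n b p → m ≡ n
degree-unique a≢0 b≢0 p↓ p↓′ = ℕ.≤-antisym
  (ℕ.s≤s⁻¹ (leadingTerm-< a≢0 p↓ (above p↓′))) (ℕ.s≤s⁻¹ (leadingTerm-< b≢0 p↓′ (above p↓)))

*-nonzero : ∀ {a b} → a ≢ 0ℚ → b ≢ 0ℚ → a * b ≢ 0ℚ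
*-nonzero a≢0 b≢0 ab≡0 = b≢0 (*-cancelˡ-0 a≢0 ab≡0)

factor-degrees : ∀ {n c f} x y → c ≢ 0ℚ → LeadingTerm n c f → f ≈ᴾ x *ᴾ y →
  ∃[ i ] ∃[ j ] ∃[ a ] ∃[ b ] a ≢ 0ℚ × b ≢ 0ℚ × LeadingTerm i a x × LeadingTerm j b y × i ℕ.+ j ≡ n
factor-degrees {n} {c} x y c≢0 f↓ f≈xy with zero⊎leadingTerm x | zero⊎leadingTerm y
... | inj₁ x≈0 | _ =
  contradiction (≡.trans (≡.sym (coefficient f↓)) (≡.trans (f≈xy n) (zero-* x y x≈0 n z≤n))) c≢0
... | inj₂ _ | inj₁ y≈0 =
  contradiction (≡.trans (≡.sym (coefficient f↓)) (≡.trans (f≈xy n) (*-zero x y y≈0 n z≤n))) c≢0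
... | inj₂ (i , a , a≢0 , x↓) | inj₂ (j , b , b≢0 , y↓) =
  i , j , a , b , a≢0 , b≢0 , x↓ , y↓ ,
  degree-unique (*-nonzero a≢0 b≢0) c≢0 (leadingTerm-* x y x↓ y↓) (leadingTerm-resp f≈xy f↓)

unit⇒degree-0 : ∀ {n a x} → a ≢ 0ℚ → LeadingTerm n a x → Unit x → n ≡ 0
unit⇒degree-0 {x = x} a≢0 x↓ (q Divisibility., qx≈1)
  with i , j , _ , _ , _ , b≢0 , _ , x↓′ , i+j≡0 ←
    factor-degrees {f = constᴾ 1ℚ} q x (λ ()) (leading ≡.refl (degreeBelow-const 1ℚ)) (≡.sym ∘ qx≈1) =
    ≡.trans (degree-unique a≢0 b≢0 x↓ x↓′) (ℕ.m+n≡0⇒n≡0 i i+j≡0)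

degree-0⇒unit : ∀ {a x} → a ≢ 0ℚ → LeadingTerm 0 a x → Unit x
degree-0⇒unit {a} {x} a≢0 (leading eq x<) with t , ta≡1 ← reciprocal a≢0 = constᴾ t Divisibility., λ where
    zero    → ≡.trans (coeff-*-∷ t [] x 0) (≡.trans (≡.cong (λ u → t * u + 0ℚ) eq) (≡.trans (ℚ.+-identityʳ _) ta≡1))
    (suc k) → degreeBelow-* (constᴾ t) x (degreeBelow-const t) x< (suc k) (s≤s z≤n)

-- Recursion on the coefficients of the dividend: if `f = qp + r`, then `c + Xf = (Xq)p + (c + Xr)`,
-- and `c + Xr` has degree at most `m`, so one multiple of `p` brings it below `m`.
division : ∀ {m a} p → a ≢ 0ℚ → LeadingTerm m a p → ∀ f →
  ∃[ q ] ∃[ r ] DegreeBelow m r × f ≈ᴾ q *ᴾ p +ᴾ r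
division p a≢0 p↓ [] = [] , [] , (λ _ _ → ≡.refl) , λ _ → ≡.refl
division {m} {a} p a≢0 p↓ (c ∷ f)
  with q , r , r< , f≈ ← division p a≢0 p↓ f | t , ta≡1 ← reciprocal a≢0 =
    s ∷ q , (c ∷ r) +ᴾ List.map (- s *_) p , below , equal
  where
  -- The quotient of the coefficient of `c ∷ r` at `m` by the leading coefficient of `p`, as `t` is
  -- the inverse of `a`.
  s = coeff (c ∷ r) m * t

  below : DegreeBelow m ((c ∷ r) +ᴾ List.map (- s *_) p)
  below k m≤k with ℕ.m≤n⇒m<n∨m≡n m≤k
  ... | inj₁ (s≤s {n = k′} m≤k′) = begin
    coeff ((c ∷ r) +ᴾ List.map (- s *_) p) k      ≡⟨ coeff-+ (c ∷ r) (List.map (- s *_) p) k ⟩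
    coeff r k′ + coeff (List.map (- s *_) p) k    ≡⟨ ≡.cong₂ _+_ (r< k′ m≤k′) (coeff-scale (- s) p k) ⟩
    0ℚ + - s * coeff p k                          ≡⟨ ≡.cong (λ u → 0ℚ + - s * u) (above p↓ k (s≤s m≤k′)) ⟩
    0ℚ + - s * 0ℚ                                 ≡⟨ solve 1 (λ x → con 0ℚ :+ x :* con 0ℚ := con 0ℚ) ≡.refl (- s) ⟩
    0ℚ                                            ∎
  ... | inj₂ ≡.refl = begin
    coeff ((c ∷ r) +ᴾ List.map (- s *_) p) m      ≡⟨ coeff-+ (c ∷ r) (List.map (- s *_) p) m ⟩
    u + coeff (List.map (- s *_) p) m             ≡⟨ ≡.cong (u +_) (coeff-scale (- s) p m) ⟩
    u + - s * coeff p m                           ≡⟨ ≡.cong (λ y → u + - s * y) (coefficient p↓) ⟩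
    u + - (u * t) * a                             ≡⟨ solve 3 (λ u t a → u :+ (:- (u :* t)) :* a := u :+ (:- (u :* (t :* a)))) ≡.refl u t a ⟩
    u + - (u * (t * a))                           ≡⟨ ≡.cong (λ y → u + - (u * y)) ta≡1 ⟩
    u + - (u * 1ℚ)                                ≡⟨ solve 1 (λ u → u :+ (:- (u :* con 1ℚ)) := con 0ℚ) ≡.refl u ⟩
    0ℚ                                            ∎
    where u = coeff (c ∷ r) m

  shifted : ∀ k → coeff (c ∷ f) k ≡ coeff (0ℚ ∷ (q *ᴾ p)) k + coeff (c ∷ r) k
  shifted zero    = ≡.sym (ℚ.+-identityˡ c)
  shifted (suc k) = ≡.trans (f≈ k) (coeff-+ (q *ᴾ p) r k)

  equal : c ∷ f ≈ᴾ (s ∷ q) *ᴾ p +ᴾ ((c ∷ r) +ᴾ List.map (- s *_) p)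
  equal k = ≡.sym (begin
    coeff ((s ∷ q) *ᴾ p +ᴾ ((c ∷ r) +ᴾ List.map (- s *_) p)) k
      ≡⟨ coeff-+ ((s ∷ q) *ᴾ p) _ k ⟩
    coeff ((s ∷ q) *ᴾ p) k + coeff ((c ∷ r) +ᴾ List.map (- s *_) p) k
      ≡⟨ ≡.cong₂ _+_ (coeff-*-∷ s q p k) (≡.trans (coeff-+ (c ∷ r) (List.map (- s *_) p) k) (≡.cong (coeff (c ∷ r) k +_) (coeff-scale (- s) p k))) ⟩
    (s * coeff p k + coeff (0ℚ ∷ (q *ᴾ p)) k) + (coeff (c ∷ r) k + - s * coeff p k)
      ≡⟨ solve 4 (λ s x y z → (s :* x :+ y) :+ (z :+ (:- s) :* x) := y :+ z) ≡.refl
           s (coeff p k) (coeff (0ℚ ∷ (q *ᴾ p)) k) (coeff (c ∷ r) k) ⟩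
    coeff (0ℚ ∷ (q *ᴾ p)) k + coeff (c ∷ r) k
      ≡⟨ shifted k ⟨
    coeff (c ∷ f) k ∎)

-- Degrees of determinants with entries of degree at most one.

degreeBelow-sum : ∀ {n m} (t : Vector Poly n) → (∀ j → DegreeBelow m (t j)) → DegreeBelow m (sumᴾ t)
degreeBelow-sum {zero}  t t< = λ _ _ → ≡.refl
degreeBelow-sum {suc n} t t< = degreeBelow-+ (t zero) (sumᴾ (t ∘ suc)) (t< zero) (degreeBelow-sum (t ∘ suc) (t< ∘ suc))

degreeBelow-sign : ∀ n → DegreeBelow 1 ((-ᴾ constᴾ 1ℚ) ^ᴾ n)
degreeBelow-sign zero    = degreeBelow-const 1ℚ
degreeBelow-sign (suc n) = degreeBelow-* (-ᴾ constᴾ 1ℚ) ((-ᴾ constᴾ 1ℚ) ^ᴾ n) (degreeBelow-const (- 1ℚ)) (degreeBelow-sign n)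

laplaceTerm : ∀ {n} → Matrix Poly (suc n) (suc n) → Vector Poly (suc n)
laplaceTerm N j = (-ᴾ constᴾ 1ℚ) ^ᴾ toℕ j *ᴾ (N zero j *ᴾ detᴾ (λ i → removeAt (N (suc i)) j))

degreeBelow-det : ∀ {n} (N : Matrix Poly n n) → (∀ i j → DegreeBelow 2 (N i j)) → DegreeBelow (suc n) (detᴾ N)

-- The degree bound `m` of the first-row entry is left open because two values occur: `m = 1` for a
-- general entry, and `m = 0` for the constant off-diagonal entries of `det-monic`.
degreeBelow-laplaceTerm : ∀ {n m} (N : Matrix Poly (suc n) (suc n)) → (∀ i j → DegreeBelow 2 (N i j)) →
  ∀ j → DegreeBelow (suc m) (N zero j) → DegreeBelow (suc m ℕ.+ n) (laplaceTerm N j)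

degreeBelow-det {zero}  N N< = degreeBelow-const 1ℚ
degreeBelow-det {suc n} N N< = degreeBelow-sum (laplaceTerm N) (λ j → degreeBelow-laplaceTerm N N< j (N< zero j))

degreeBelow-laplaceTerm N N< j N₀j< =
  degreeBelow-* ((-ᴾ constᴾ 1ℚ) ^ᴾ toℕ j) (N zero j *ᴾ minor) (degreeBelow-sign (toℕ j))
    (degreeBelow-* (N zero j) minor N₀j<
      (degreeBelow-det (λ i → removeAt (N (suc i)) j) (λ i l → N< (suc i) (punchIn j l))))
  where minor = detᴾ (λ i → removeAt (N (suc i)) j)

-- Only the first Laplace term reaches degree `n`. In every other term the first-row entry is off
-- the diagonal, hence constant, while the minor has degree at most its size, which is one less than
-- `n`.
det-monic : ∀ {n} (N : Matrix Poly n n) → (∀ i → LeadingTerm 1 1ℚ (N i i)) →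
  (∀ {i j} → i ≢ j → DegreeBelow 1 (N i j)) → LeadingTerm n 1ℚ (detᴾ N)
det-monic {zero}  N diag off = leading ≡.refl (degreeBelow-const 1ℚ)
det-monic {suc n} N diag off = leadingTerm-+ (laplaceTerm N zero) (sumᴾ (laplaceTerm N ∘ suc))
  (leadingTerm-* (constᴾ 1ℚ) (N zero zero *ᴾ minor) (leading ≡.refl (degreeBelow-const 1ℚ))
    (leadingTerm-* (N zero zero) minor (diag zero)
      (det-monic (λ i j → N (suc i) (suc j)) (diag ∘ suc) (λ i≢j → off (i≢j ∘ Fin.suc-injective)))))
  (degreeBelow-sum (laplaceTerm N ∘ suc) (λ j → degreeBelow-laplaceTerm N entry (suc j) (off λ ())))
  where
  minor = detᴾ (λ i j → N (suc i) (suc j))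

  entry : ∀ i j → DegreeBelow 2 (N i j)
  entry i j with i Fin.≟ j
  ... | yes ≡.refl = above (diag i)
  ... | no i≢j     = degreeBelow-mono {p = N i j} (s≤s z≤n) (off i≢j)

charPoly-monic : ∀ {d} (A : Matrix ℚ d d) → LeadingTerm d 1ℚ (charPoly A)
charPoly-monic A = det-monic _ diag off
  where
  diag : ∀ i → LeadingTerm 1 1ℚ (X *ᴾ 1ᴾ i i +ᴾ (-ᴾ constᴾ (A i i)))
  diag i with i Fin.≟ i
  ... | yes _  = leading ≡.refl λ { (suc (suc zero)) _ → ≡.refl ; (suc (suc (suc k))) _ → ≡.refl ; (suc zero) (s≤s ()) }
  ... | no i≢i = contradiction ≡.refl i≢i
  off : ∀ {i j} → i ≢ j → DegreeBelow 1 (X *ᴾ 1ᴾ i j +ᴾ (-ᴾ constᴾ (A i j)))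
  off {i} {j} i≢j with i Fin.≟ j
  ... | yes i≡j = contradiction i≡j i≢j
  ... | no _    = λ { (suc zero) _ → ≡.refl ; (suc (suc k)) _ → ≡.refl }

-- The action of polynomials in a matrix

module Action {d} (A : Matrix ℚ d d) where

  act : Poly → Vector ℚ d → Vector ℚ d
  act []      v i = 0ℚ
  act (a ∷ p) v i = a * v i + (A ·ᵛ act p v) i

  act-cong : ∀ p {u v} → u ≗ v → act p u ≗ act p v
  act-cong []      u≗v i = ≡.refl
  act-cong (a ∷ p) u≗v i = ≡.cong₂ (λ x y → a * x + y) (u≗v i) (·ᵛ-cong A (act-cong p u≗v) i)

  act-zero : ∀ p v → DegreeBelow 0 p → act p v ≗ 0ᵛ
  act-zero []      v p≈0 i = ≡.refl
  act-zero (a ∷ p) v p≈0 i = begin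
    a * v i + (A ·ᵛ act p v) i
      ≡⟨ ≡.cong₂ (λ x y → x * v i + y) (p≈0 0 z≤n) (·ᵛ-cong A (act-zero p v (λ k _ → p≈0 (suc k) z≤n)) i) ⟩
    0ℚ * v i + (A ·ᵛ 0ᵛ) i   ≡⟨ ≡.cong₂ _+_ (ℚ.*-zeroˡ (v i)) (·ᵛ-0 A i) ⟩
    0ℚ                       ∎

  act-resp : ∀ p q → p ≈ᴾ q → ∀ v → act p v ≗ act q v
  act-resp []      q       p≈q v i = ≡.sym (act-zero q v (λ k _ → ≡.sym (p≈q k)) i)
  act-resp (a ∷ p) []      p≈q v i = act-zero (a ∷ p) v (λ k _ → p≈q k) i
  act-resp (a ∷ p) (b ∷ q) p≈q v i =
    ≡.cong₂ (λ x y → x * v i + y) (p≈q 0) (·ᵛ-cong A (act-resp p q (p≈q ∘ suc) v) i)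

  act-+ : ∀ p q v i → act (p +ᴾ q) v i ≡ act p v i + act q v i
  act-+ []      q       v i = ≡.sym (ℚ.+-identityˡ _)
  act-+ (a ∷ p) []      v i = ≡.sym (ℚ.+-identityʳ _)
  act-+ (a ∷ p) (b ∷ q) v i = begin
    (a + b) * v i + (A ·ᵛ act (p +ᴾ q) v) i
      ≡⟨ ≡.cong ((a + b) * v i +_) (≡.trans (·ᵛ-cong A (act-+ p q v) i) (·ᵛ-+ A (act p v) (act q v) i)) ⟩
    (a + b) * v i + ((A ·ᵛ act p v) i + (A ·ᵛ act q v) i)
      ≡⟨ solve 5 (λ a b v x y → (a :+ b) :* v :+ (x :+ y) := (a :* v :+ x) :+ (b :* v :+ y)) ≡.refl
           a b (v i) ((A ·ᵛ act p v) i) ((A ·ᵛ act q v) i) ⟩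
    (a * v i + (A ·ᵛ act p v) i) + (b * v i + (A ·ᵛ act q v) i) ∎

  act-scale : ∀ a p v i → act (List.map (a *_) p) v i ≡ a * act p v i
  act-scale a []      v i = ≡.sym (ℚ.*-zeroʳ a)
  act-scale a (b ∷ p) v i = begin
    a * b * v i + (A ·ᵛ act (List.map (a *_) p) v) i
      ≡⟨ ≡.cong (a * b * v i +_) (≡.trans (·ᵛ-cong A (act-scale a p v) i) (·ᵛ-* A a (act p v) i)) ⟩
    a * b * v i + a * (A ·ᵛ act p v) i
      ≡⟨ solve 4 (λ a b v x → a :* b :* v :+ a :* x := a :* (b :* v :+ x)) ≡.refl a b (v i) ((A ·ᵛ act p v) i) ⟩
    a * (b * v i + (A ·ᵛ act p v) i) ∎

  act-neg : ∀ p v i → act (-ᴾ p) v i ≡ - act p v i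
  act-neg []      v i = ≡.refl
  act-neg (b ∷ p) v i = begin
    - b * v i + (A ·ᵛ act (-ᴾ p) v) i
      ≡⟨ ≡.cong (- b * v i +_) (·ᵛ-cong A (λ j → ≡.trans (act-neg p v j) (solve 1 (λ x → :- x := con (- 1ℚ) :* x) ≡.refl (act p v j))) i) ⟩
    - b * v i + (A ·ᵛ (λ j → - 1ℚ * act p v j)) i
      ≡⟨ ≡.cong (- b * v i +_) (·ᵛ-* A (- 1ℚ) (act p v) i) ⟩
    - b * v i + - 1ℚ * (A ·ᵛ act p v) i
      ≡⟨ solve 3 (λ b v x → (:- b) :* v :+ con (- 1ℚ) :* x := :- (b :* v :+ x)) ≡.refl b (v i) ((A ·ᵛ act p v) i) ⟩
    - (b * v i + (A ·ᵛ act p v) i) ∎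

  act-shift : ∀ p v i → act (0ℚ ∷ p) v i ≡ (A ·ᵛ act p v) i
  act-shift p v i = solve 2 (λ v x → con 0ℚ :* v :+ x := x) ≡.refl (v i) ((A ·ᵛ act p v) i)

  act-const : ∀ a v i → act (constᴾ a) v i ≡ a * v i
  act-const a v i = ≡.trans (≡.cong (a * v i +_) (·ᵛ-0 A i)) (ℚ.+-identityʳ _)

  act-* : ∀ p q v → act (p *ᴾ q) v ≗ act p (act q v)
  act-* []      q v i = ≡.refl
  act-* (a ∷ p) q v i = begin
    act (List.map (a *_) q +ᴾ (0ℚ ∷ p *ᴾ q)) v i
      ≡⟨ act-+ (List.map (a *_) q) (0ℚ ∷ p *ᴾ q) v i ⟩
    act (List.map (a *_) q) v i + act (0ℚ ∷ p *ᴾ q) v i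
      ≡⟨ ≡.cong₂ _+_ (act-scale a q v i) (≡.trans (act-shift (p *ᴾ q) v i) (·ᵛ-cong A (act-* p q v) i)) ⟩
    a * act q v i + (A ·ᵛ act p (act q v)) i ∎

  act-linear-+ : ∀ p u v i → act p (λ j → u j + v j) i ≡ act p u i + act p v i
  act-linear-+ []      u v i = ≡.refl
  act-linear-+ (a ∷ p) u v i = begin
    a * (u i + v i) + (A ·ᵛ act p (λ j → u j + v j)) i
      ≡⟨ ≡.cong (a * (u i + v i) +_) (≡.trans (·ᵛ-cong A (act-linear-+ p u v) i) (·ᵛ-+ A (act p u) (act p v) i)) ⟩
    a * (u i + v i) + ((A ·ᵛ act p u) i + (A ·ᵛ act p v) i)
      ≡⟨ solve 5 (λ a u v x y → a :* (u :+ v) :+ (x :+ y) := (a :* u :+ x) :+ (a :* v :+ y)) ≡.refl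
           a (u i) (v i) ((A ·ᵛ act p u) i) ((A ·ᵛ act p v) i) ⟩
    (a * u i + (A ·ᵛ act p u) i) + (a * v i + (A ·ᵛ act p v) i) ∎

  act-linear-* : ∀ p b v i → act p (λ j → b * v j) i ≡ b * act p v i
  act-linear-* []      b v i = ≡.sym (ℚ.*-zeroʳ b)
  act-linear-* (a ∷ p) b v i = begin
    a * (b * v i) + (A ·ᵛ act p (λ j → b * v j)) i
      ≡⟨ ≡.cong (a * (b * v i) +_) (≡.trans (·ᵛ-cong A (act-linear-* p b v) i) (·ᵛ-* A b (act p v) i)) ⟩
    a * (b * v i) + b * (A ·ᵛ act p v) i
      ≡⟨ solve 4 (λ a b v x → a :* (b :* v) :+ b :* x := b :* (a :* v :+ x)) ≡.refl a b (v i) ((A ·ᵛ act p v) i) ⟩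
    b * (a * v i + (A ·ᵛ act p v) i) ∎

  act-·ᵛ : ∀ p v → act p (A ·ᵛ v) ≗ A ·ᵛ act p v
  act-·ᵛ []      v i = ≡.sym (·ᵛ-0 A i)
  act-·ᵛ (a ∷ p) v i = begin
    a * (A ·ᵛ v) i + (A ·ᵛ act p (A ·ᵛ v)) i
      ≡⟨ ≡.cong₂ _+_ (≡.sym (·ᵛ-* A a v i)) (·ᵛ-cong A (act-·ᵛ p v) i) ⟩
    (A ·ᵛ (λ j → a * v j)) i + (A ·ᵛ (A ·ᵛ act p v)) i
      ≡⟨ ·ᵛ-+ A (λ j → a * v j) (A ·ᵛ act p v) i ⟨
    (A ·ᵛ act (a ∷ p) v) i ∎

  act-comm : ∀ p q v → act p (act q v) ≗ act q (act p v)
  act-comm []      q v i = begin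
    0ℚ                    ≡⟨ ℚ.*-zeroˡ (act q 0ᵛ i) ⟨
    0ℚ * act q 0ᵛ i       ≡⟨ act-linear-* q 0ℚ 0ᵛ i ⟨
    act q (λ j → 0ℚ) i    ∎
  act-comm (a ∷ p) q v i = begin
    a * act q v i + (A ·ᵛ act p (act q v)) i
      ≡⟨ ≡.cong (a * act q v i +_) (·ᵛ-cong A (act-comm p q v) i) ⟩
    a * act q v i + (A ·ᵛ act q (act p v)) i
      ≡⟨ ≡.cong₂ _+_ (act-linear-* q a v i) (act-·ᵛ q (act p v) i) ⟨
    act q (λ j → a * v j) i + act q (A ·ᵛ act p v) i
      ≡⟨ act-linear-+ q (λ j → a * v j) (A ·ᵛ act p v) i ⟨
    act q (act (a ∷ p) v) i ∎

  infix 4 _~_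
  -- Equality of the operators `p(A)` and `q(A)`. Being a record, it keeps `p` and `q` visible to
  -- unification, which could not recover them from values of `act`.
  record _~_ (p q : Poly) : Set where
    constructor same
    field act-≗ : ∀ v → act p v ≗ act q v
  open _~_

  -- Modulo p(A) = q(A) the ring axioms hold because they hold for operators.
  ~-isCommutativeRing : IsCommutativeRing _~_ _+ᴾ_ _*ᴾ_ -ᴾ_ [] (constᴾ 1ℚ)
  ~-isCommutativeRing = record
    { isRing = record
      { +-isAbelianGroup = record
        { isGroup = record
          { isMonoid = record
            { isSemigroup = record
              { isMagma = record
                { isEquivalence = record
                  { refl  = same λ v i → ≡.refl
                  ; sym   = λ p~q → same λ v i → ≡.sym (act-≗ p~q v i)
                  ; trans = λ p~q q~r → same λ v i → ≡.trans (act-≗ p~q v i) (act-≗ q~r v i)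
                  }
                ; ∙-cong = λ {p} {p′} {q} {q′} p~ q~ → same λ v i →
                    ≡.trans (act-+ p q v i) (≡.trans (≡.cong₂ _+_ (act-≗ p~ v i) (act-≗ q~ v i)) (≡.sym (act-+ p′ q′ v i)))
                }
              ; assoc = λ p q r → same λ v i → begin
                  act (p +ᴾ q +ᴾ r) v i                ≡⟨ act-+ (p +ᴾ q) r v i ⟩
                  act (p +ᴾ q) v i + act r v i         ≡⟨ ≡.cong (_+ act r v i) (act-+ p q v i) ⟩
                  act p v i + act q v i + act r v i    ≡⟨ ℚ.+-assoc (act p v i) (act q v i) (act r v i) ⟩
                  act p v i + (act q v i + act r v i)  ≡⟨ ≡.cong (act p v i +_) (act-+ q r v i) ⟨
                  act p v i + act (q +ᴾ r) v i         ≡⟨ act-+ p (q +ᴾ r) v i ⟨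
                  act (p +ᴾ (q +ᴾ r)) v i              ∎
              }
            ; identity = (λ p → same λ v i → ≡.refl) ,
                (λ p → same λ v i → ≡.trans (act-+ p [] v i) (ℚ.+-identityʳ _))
            }
          ; inverse = (λ p → same λ v i → ≡.trans (act-+ (-ᴾ p) p v i)
                         (≡.trans (≡.cong (_+ act p v i) (act-neg p v i)) (ℚ.+-inverseˡ (act p v i)))) ,
                      (λ p → same λ v i → ≡.trans (act-+ p (-ᴾ p) v i)
                         (≡.trans (≡.cong (act p v i +_) (act-neg p v i)) (ℚ.+-inverseʳ (act p v i))))
          ; ⁻¹-cong = λ {p} {q} p~q → same λ v i →
              ≡.trans (act-neg p v i) (≡.trans (≡.cong -_ (act-≗ p~q v i)) (≡.sym (act-neg q v i)))
          }
        ; comm = λ p q → same λ v i →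
            ≡.trans (act-+ p q v i) (≡.trans (ℚ.+-comm (act p v i) (act q v i)) (≡.sym (act-+ q p v i)))
        }
      ; *-cong = λ {p} {p′} {q} {q′} p~ q~ → same λ v i → begin
          act (p *ᴾ q) v i      ≡⟨ act-* p q v i ⟩
          act p (act q v) i     ≡⟨ act-≗ p~ (act q v) i ⟩
          act p′ (act q v) i    ≡⟨ act-cong p′ (act-≗ q~ v) i ⟩
          act p′ (act q′ v) i   ≡⟨ act-* p′ q′ v i ⟨
          act (p′ *ᴾ q′) v i    ∎
      ; *-assoc = λ p q r → same λ v i → begin
          act (p *ᴾ q *ᴾ r) v i       ≡⟨ act-* (p *ᴾ q) r v i ⟩
          act (p *ᴾ q) (act r v) i    ≡⟨ act-* p q (act r v) i ⟩
          act p (act q (act r v)) i   ≡⟨ act-cong p (act-* q r v) i ⟨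
          act p (act (q *ᴾ r) v) i    ≡⟨ act-* p (q *ᴾ r) v i ⟨
          act (p *ᴾ (q *ᴾ r)) v i     ∎
      ; *-identity = (λ p → same λ v i → begin
          act (constᴾ 1ℚ *ᴾ p) v i        ≡⟨ act-* (constᴾ 1ℚ) p v i ⟩
          act (constᴾ 1ℚ) (act p v) i     ≡⟨ act-1 (act p v) i ⟩
          act p v i                       ∎) ,
        (λ p → same λ v i → begin
          act (p *ᴾ constᴾ 1ℚ) v i        ≡⟨ act-* p (constᴾ 1ℚ) v i ⟩
          act p (act (constᴾ 1ℚ) v) i     ≡⟨ act-cong p (act-1 v) i ⟩
          act p v i                       ∎)
      ; distrib = (λ p q r → same λ v i → begin
          act (p *ᴾ (q +ᴾ r)) v i                     ≡⟨ act-* p (q +ᴾ r) v i ⟩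
          act p (act (q +ᴾ r) v) i                    ≡⟨ act-cong p (act-+ q r v) i ⟩
          act p (λ j → act q v j + act r v j) i       ≡⟨ act-linear-+ p (act q v) (act r v) i ⟩
          act p (act q v) i + act p (act r v) i       ≡⟨ ≡.cong₂ _+_ (act-* p q v i) (act-* p r v i) ⟨
          act (p *ᴾ q) v i + act (p *ᴾ r) v i         ≡⟨ act-+ (p *ᴾ q) (p *ᴾ r) v i ⟨
          act (p *ᴾ q +ᴾ p *ᴾ r) v i                  ∎) ,
        (λ p q r → same λ v i → begin
          act ((q +ᴾ r) *ᴾ p) v i                     ≡⟨ act-* (q +ᴾ r) p v i ⟩
          act (q +ᴾ r) (act p v) i                    ≡⟨ act-+ q r (act p v) i ⟩
          act q (act p v) i + act r (act p v) i       ≡⟨ ≡.cong₂ _+_ (act-* q p v i) (act-* r p v i) ⟨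
          act (q *ᴾ p) v i + act (r *ᴾ p) v i         ≡⟨ act-+ (q *ᴾ p) (r *ᴾ p) v i ⟨
          act (q *ᴾ p +ᴾ r *ᴾ p) v i                  ∎)
      }
    ; *-comm = λ p q → same λ v i → begin
        act (p *ᴾ q) v i    ≡⟨ act-* p q v i ⟩
        act p (act q v) i   ≡⟨ act-comm p q v i ⟩
        act q (act p v) i   ≡⟨ act-* q p v i ⟨
        act (q *ᴾ p) v i    ∎
    }
    where
    act-1 : ∀ v → act (constᴾ 1ℚ) v ≗ v
    act-1 v i = ≡.trans (act-const 1ℚ v i) (ℚ.*-identityˡ (v i))

  -- The Cayley-Hamilton theorem.

  open AlternatingForms ℚ[X] _~_ ~-isCommutativeRing using (det-submodule)

  -- The tuples x of polynomials with Σ_c ε_c ∘ x_c(A) = 0, ε_c being the coordinate functionals.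
  Relation : Vector Poly d → Set
  Relation x = ∀ v → sum (λ c → act (x c) v c) ≡ 0ℚ

  charMatrix-relation : ∀ i → Relation (λ c → X *ᴾ 1ᴾ i c +ᴾ (-ᴾ constᴾ (A i c)))
  charMatrix-relation i v = begin
    sum (λ c → act (X *ᴾ 1ᴾ i c +ᴾ (-ᴾ constᴾ (A i c))) v c)
      ≡⟨ sum-cong-≗ (λ c → act-+ (X *ᴾ 1ᴾ i c) (-ᴾ constᴾ (A i c)) v c) ⟩
    sum (λ c → act (X *ᴾ 1ᴾ i c) v c + act (-ᴾ constᴾ (A i c)) v c)
      ≡⟨ ∑-distrib-+ (λ c → act (X *ᴾ 1ᴾ i c) v c) (λ c → act (-ᴾ constᴾ (A i c)) v c) ⟩
    sum (λ c → act (X *ᴾ 1ᴾ i c) v c) + sum (λ c → act (-ᴾ constᴾ (A i c)) v c)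
      ≡⟨ ≡.cong₂ _+_ (≡.trans (sum-single i _ off) diag) (sum-cong-≗ entry) ⟩
    (A ·ᵛ v) i + sum (λ c → - 1ℚ * (A i c * v c))
      ≡⟨ ≡.cong ((A ·ᵛ v) i +_) (*-distribˡ-sum (- 1ℚ) (λ c → A i c * v c)) ⟨
    (A ·ᵛ v) i + - 1ℚ * (A ·ᵛ v) i
      ≡⟨ solve 1 (λ x → x :+ con (- 1ℚ) :* x := con 0ℚ) ≡.refl ((A ·ᵛ v) i) ⟩
    0ℚ ∎
    where
    act-X : ∀ v → act X v ≗ A ·ᵛ v
    act-X v j = ≡.trans (act-shift (constᴾ 1ℚ) v j)
      (·ᵛ-cong A (λ l → ≡.trans (act-const 1ℚ v l) (ℚ.*-identityˡ (v l))) j)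

    diag : act (X *ᴾ 1ᴾ i i) v i ≡ (A ·ᵛ v) i
    diag with i Fin.≟ i
    ... | no i≢i = contradiction ≡.refl i≢i
    ... | yes _  = begin
      act (X *ᴾ constᴾ 1ℚ) v i     ≡⟨ act-* X (constᴾ 1ℚ) v i ⟩
      act X (act (constᴾ 1ℚ) v) i  ≡⟨ act-cong X (λ l → ≡.trans (act-const 1ℚ v l) (ℚ.*-identityˡ (v l))) i ⟩
      act X v i                    ≡⟨ act-X v i ⟩
      (A ·ᵛ v) i                   ∎

    off : ∀ c → c ≢ i → act (X *ᴾ 1ᴾ i c) v c ≡ 0ℚ
    off c c≢i with i Fin.≟ c
    ... | yes i≡c = contradiction (≡.sym i≡c) c≢i
    ... | no _    = act-zero (X *ᴾ []) v (*-zero X [] (λ _ _ → ≡.refl)) c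

    entry : ∀ c → act (-ᴾ constᴾ (A i c)) v c ≡ - 1ℚ * (A i c * v c)
    entry c = ≡.trans (act-const (- A i c) v c)
      (solve 2 (λ a v → (:- a) :* v := con (- 1ℚ) :* (a :* v)) ≡.refl (A i c) (v c))

  -- The relation obtained from `det-submodule` has `charPoly A` as its only nonzero entry, at `j`;
  -- evaluated at `v` it is exactly coordinate `j` of `χ(A)v`.
  cayley-hamilton : ∀ v → act (charPoly A) v ≗ 0ᵛ
  cayley-hamilton v j = begin
    act (charPoly A) v j                ≡⟨ act-≗ x-diag v j ⟨
    act (x j) v j                       ≡⟨ sum-single j (λ c → act (x c) v c) (λ c c≢j → act-≗ (x-off c c≢j) v c) ⟨
    sum (λ c → act (x c) v c)           ≡⟨ relation v ⟩
    0ℚ                                  ∎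
    where
    x : Vector Poly d
    x c = if ⌊ c Fin.≟ j ⌋ then charPoly A else []

    x-diag : x j ~ charPoly A
    x-diag with j Fin.≟ j
    ... | yes _  = same λ v i → ≡.refl
    ... | no j≢j = contradiction ≡.refl j≢j

    x-off : ∀ c → c ≢ j → x c ~ []
    x-off c c≢j with c Fin.≟ j
    ... | yes c≡j = contradiction c≡j c≢j
    ... | no _    = same λ v i → ≡.refl

    relation : Relation x
    relation = det-submodule Relation
      (λ x~y Kx v → ≡.trans (sum-cong-≗ (λ c → ≡.sym (act-≗ (x~y c) v c))) (Kx v))
      (λ v → sum-zero {d} {0ᵛ} (λ c → ≡.refl))
      (λ {x} {y} Kx Ky v → ≡.trans (sum-cong-≗ (λ c → act-+ (x c) (y c) v c))
        (≡.trans (∑-distrib-+ (λ c → act (x c) v c) (λ c → act (y c) v c)) (≡.cong₂ _+_ (Kx v) (Ky v))))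
      -- Multiplying a relation by `a` amounts to evaluating it at `a(A)v`, because polynomials in
      -- `A` commute.
      (λ a {x} Kx v → ≡.trans
        (sum-cong-≗ (λ c → ≡.trans (act-* a (x c) v c) (act-comm a (x c) v c))) (Kx (act a v)))
      (λ i c → X *ᴾ 1ᴾ i c +ᴾ (-ᴾ constᴾ (A i c))) charMatrix-relation j x-diag x-off

  -- Krylov families and annihilating polynomials.

  iterate : ℕ → Vector ℚ d → Vector ℚ d
  iterate zero    v = v
  iterate (suc n) v = A ·ᵛ iterate n v

  krylov : ∀ m → Vector ℚ d → Vector (Vector ℚ d) m
  krylov m v j = iterate (toℕ j) v

  act-krylov : ∀ m p v → DegreeBelow m p → act p v ≗ linComb (λ j → coeff p (toℕ j)) (krylov m v)
  act-krylov zero    p       v p< i = act-zero p v p< i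
  act-krylov (suc m) []      v p< i = ≡.sym (linComb-0 (krylov (suc m) v) i)
  act-krylov (suc m) (a ∷ p) v p< i = ≡.cong (a * v i +_) (begin
    (A ·ᵛ act p v) i
      ≡⟨ ·ᵛ-cong A (act-krylov m p v (λ k m≤k → p< (suc k) (s≤s m≤k))) i ⟩
    (A ·ᵛ linComb (λ j → coeff p (toℕ j)) (krylov m v)) i
      ≡⟨ ·ᵛ-linComb A (λ j → coeff p (toℕ j)) (krylov m v) i ⟩
    linComb (λ j → coeff p (toℕ j)) (λ j → A ·ᵛ krylov m v j) i ∎)

  act-toList : ∀ {m} (c : Vector ℚ m) v → act (toList c) v ≗ linComb c (krylov m v)
  act-toList {m} c v i = ≡.trans (act-krylov m (toList c) v (degreeBelow-toList c) i)
    (linComb-congˡ (krylov m v) (coeff-toList c) i)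

  record Annihilator (v : Vector ℚ d) (degree : ℕ) : Set where
    field
      poly         : Poly
      lead         : ℚ
      lead≢0       : lead ≢ 0ℚ
      leadingTerm  : LeadingTerm degree lead poly
      annihilates  : act poly v ≗ 0ᵛ
  open Annihilator

  dependent⇒annihilator : ∀ {m} v → Dependent (krylov m v) → ∃[ n ] n < m × Annihilator v n
  dependent⇒annihilator {m} v (c , c≢0 , c·b≗0) with zero⊎leadingTerm (toList c)
  ... | inj₁ c≈0 = contradiction (λ j → ≡.trans (≡.sym (coeff-toList c j)) (c≈0 (toℕ j) z≤n)) c≢0
  ... | inj₂ (n , a , a≢0 , c↓) = n , leadingTerm-< a≢0 c↓ (degreeBelow-toList c) , record
    { poly        = toList c
    ; lead        = a
    ; lead≢0      = a≢0
    ; leadingTerm = c↓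
    ; annihilates = λ i → ≡.trans (act-toList c v i) (c·b≗0 i)
    }

  -- Minimality is expressed as independence of the first `n` Krylov vectors: no nonzero polynomial
  -- of degree below `n` kills `v`. As long as they are dependent, the dependence is itself an
  -- annihilator of smaller degree.
  minimalAnnihilator : ∀ {m} v → Annihilator v m →
    ∃[ n ] n ≤ m × Annihilator v n × Independent (krylov n v)
  minimalAnnihilator {m} v = descend m ℕ.≤-refl
    where
    -- The degree may drop by more than one at a time, so the recursion runs on `bound`.
    descend : ∀ bound {m} → m ≤ bound → Annihilator v m → ∃[ n ] n ≤ m × Annihilator v n × Independent (krylov n v)
    descend bound {m} m≤ ann with dependent⊎independent (krylov m v)
    ... | inj₂ (indep , _) = m , ℕ.≤-refl , ann , indep
    ... | inj₁ dep with dependent⇒annihilator v dep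
    descend zero    z≤n ann | inj₁ dep | n , () , ann′
    descend (suc bound) m≤ ann | inj₁ dep | n , n<m , ann′
      with l , l≤n , rest ← descend bound (ℕ.s≤s⁻¹ (ℕ.≤-trans n<m m≤)) ann′ =
        l , ℕ.≤-trans l≤n (ℕ.<⇒≤ n<m) , rest

  annihilator-degree≢0 : ∀ {v} → ¬ v ≗ 0ᵛ → ¬ Annihilator v 0
  annihilator-degree≢0 {v} v≢0 ann = v≢0 (λ i → *-cancelˡ-0 (lead≢0 ann) (begin
    lead ann * v i                ≡⟨ ≡.cong (_* v i) (coefficient (leadingTerm ann)) ⟨
    coeff (poly ann) 0 * v i      ≡⟨ ℚ.+-identityʳ _ ⟨
    coeff (poly ann) 0 * v i + 0ℚ ≡⟨ act-krylov 1 (poly ann) v (above (leadingTerm ann)) i ⟨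
    act (poly ann) v i            ≡⟨ annihilates ann i ⟩
    0ℚ                            ∎))

  remainder : ∀ {m v} (ann : Annihilator v m) f →
    ∃[ q ] ∃[ r ] DegreeBelow m r × f ≈ᴾ q *ᴾ poly ann +ᴾ r × act f v ≗ act r v
  remainder {v = v} ann f with division (poly ann) (lead≢0 ann) (leadingTerm ann) f
  ... | q , r , r< , f≈ = q , r , r< , f≈ , λ i → begin
    act f v i
      ≡⟨ act-resp f (q *ᴾ poly ann +ᴾ r) f≈ v i ⟩
    act (q *ᴾ poly ann +ᴾ r) v i
      ≡⟨ act-+ (q *ᴾ poly ann) r v i ⟩
    act (q *ᴾ poly ann) v i + act r v i
      ≡⟨ ≡.cong (_+ act r v i) (≡.trans (act-* q (poly ann) v i) (act-cong q (annihilates ann) i)) ⟩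
    act q 0ᵛ i + act r v i
      -- Commuting `q` with the zero polynomial shows that `act q 0ᵛ` vanishes.
      ≡⟨ ≡.cong (_+ act r v i) (act-comm [] q v i) ⟨
    0ℚ + act r v i
      ≡⟨ ℚ.+-identityˡ _ ⟩
    act r v i ∎

  act∈krylov : ∀ {m v} → Annihilator v m → ∀ f → act f v ∈ Carrier (Span (krylov m v))
  act∈krylov {m} {v} ann f =
    let _ , r , r< , _ , act≗ = remainder ann f
    in (λ j → coeff r (toℕ j)) , λ i → ≡.trans (act≗ i) (act-krylov m r v r< i)

  krylov-invariant : ∀ {m v u} → Annihilator v m →
    u ∈ Carrier (Span (krylov m v)) → A ·ᵛ u ∈ Carrier (Span (krylov m v))
  krylov-invariant {m} {v} {u} ann (c , u≗) = Subspace.resp (Span (krylov m v)) (λ i → begin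
    act (0ℚ ∷ toList c) v i           ≡⟨ act-shift (toList c) v i ⟩
    (A ·ᵛ act (toList c) v) i         ≡⟨ ·ᵛ-cong A (act-toList c v) i ⟩
    (A ·ᵛ linComb c (krylov m v)) i   ≡⟨ ·ᵛ-cong A u≗ i ⟨
    (A ·ᵛ u) i                        ∎) (act∈krylov ann (0ℚ ∷ toList c))

  -- The remainder of `f` also kills `v` and has degree below `m`, so its coefficients form a
  -- relation among independent Krylov vectors and are all zero.
  minimalAnnihilator-divides : ∀ {m v} (ann : Annihilator v m) → Independent (krylov m v) →
    ∀ f → act f v ≗ 0ᵛ → ∃[ q ] f ≈ᴾ q *ᴾ poly ann
  minimalAnnihilator-divides {m} {v} ann indep f f·v≗0 =
    let q , r , r< , f≈ , act≗ = remainder ann f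
    in q , λ k → begin
      coeff f k                             ≡⟨ f≈ k ⟩
      coeff (q *ᴾ poly ann +ᴾ r) k          ≡⟨ coeff-+ (q *ᴾ poly ann) r k ⟩
      coeff (q *ᴾ poly ann) k + coeff r k
        ≡⟨ ≡.cong (coeff (q *ᴾ poly ann) k +_) (vanishes r r< (λ i → ≡.trans (≡.sym (act≗ i)) (f·v≗0 i)) k) ⟩
      coeff (q *ᴾ poly ann) k + 0ℚ          ≡⟨ ℚ.+-identityʳ _ ⟩
      coeff (q *ᴾ poly ann) k               ∎
    where
    vanishes : ∀ r → DegreeBelow m r → act r v ≗ 0ᵛ → ∀ k → coeff r k ≡ 0ℚ
    vanishes r r< r·v≗0 k with k ℕ.<? m
    ... | no k≮m  = r< k (ℕ.≮⇒≥ k≮m)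
    ... | yes k<m = ≡.trans (≡.cong (coeff r) (≡.sym (Fin.toℕ-fromℕ< k<m)))
      (indep (λ j → coeff r (toℕ j))
        (λ i → ≡.trans (≡.sym (act-krylov m r v r< i)) (r·v≗0 i)) (fromℕ< k<m))

-- Irreducible pairs

linComb-closed : ∀ {k d} (U : Subspace d) (c : Vector ℚ k) (b : Vector (Vector ℚ d) k) →
  (∀ j → b j ∈ Carrier U) → linComb c b ∈ Carrier U
linComb-closed {zero}  U c b b∈U = Subspace.0-closed U
linComb-closed {suc k} U c b b∈U =
  Subspace.+-closed U (Subspace.·-closed U (c zero) (b∈U zero)) (linComb-closed U (c ∘ suc) (b ∘ suc) (b∈U ∘ suc))

image-Span : ∀ {k d} (A : Matrix ℚ d d) (b : Vector (Vector ℚ d) k) (V : Subspace d) →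
  (∀ j → A ·ᵛ b j ∈ Carrier V) → image A (Span b) ⊆ Carrier V
image-Span A b V Ab∈V {w} (u , (c , u≗) , w≗) = Subspace.resp V
  (λ i → begin
    linComb c (λ j → A ·ᵛ b j) i  ≡⟨ ·ᵛ-linComb A c b i ⟨
    (A ·ᵛ linComb c b) i          ≡⟨ ·ᵛ-cong A u≗ i ⟨
    (A ·ᵛ u) i                    ≡⟨ w≗ i ⟨
    w i                           ∎)
  (linComb-closed V c (λ j → A ·ᵛ b j) Ab∈V)

irreduciblePair-sym : ∀ {d} (P Q : Matrix ℚ d d) → IrreduciblePair P Q → IrreduciblePair Q P
irreduciblePair-sym P Q irr (U , V , U-nt , V-nt , dim , QU⊆V , PU⊆V) = irr (U , V , U-nt , V-nt , dim , PU⊆V , QU⊆V)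

reducible : ∀ {k d} (P Q : Matrix ℚ d d) (b b′ : Vector (Vector ℚ d) (suc k)) → suc k < d →
  Independent b → Independent b′ →
  (∀ j → P ·ᵛ b j ∈ Carrier (Span b′)) → (∀ j → Q ·ᵛ b j ∈ Carrier (Span b′)) → ¬ IrreduciblePair P Q
reducible {k} P Q b b′ k<d indep indep′ Pb∈ Qb∈ irr = irr
  ( Span b , Span b′ , Span-nontrivial b indep k<d , Span-nontrivial b′ indep′ k<d
  , (suc k , (b , Span-basis b indep) , (b′ , Span-basis b′ indep′))
  , image-Span P b (Span b′) Pb∈ , image-Span Q b (Span b′) Qb∈ )

-- For a nonzero `v` with `Pv = 0`, take the lines of `v` and of `Qv`. If `Qv` vanishes as well,
-- both images are zero and the line of `v` serves as `V` too.
irreducible⇒independent : ∀ {d} → 2 ≤ d → (P Q : Matrix ℚ d d) → IrreduciblePair P Q → Independent (columns P)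
irreducible⇒independent {d} 2≤d P Q irr with dependent⊎independent (columns P)
... | inj₂ (indep , _) = indep
... | inj₁ (v , v≢0 , Pv≗0) = contradiction irr (reducible-by (Fin.all? (λ i → (Q ·ᵛ v) i ℚ.≟ 0ℚ)))
  where
  zero∈ : ∀ {u} (U : Subspace d) → u ≗ 0ᵛ → u ∈ Carrier U
  zero∈ U u≗0 = Subspace.resp U (≡.sym ∘ u≗0) (Subspace.0-closed U)

  P·v≗0 : P ·ᵛ v ≗ 0ᵛ
  P·v≗0 i = ≡.trans (·ᵛ-linComb-columns P v i) (Pv≗0 i)

  line : Vector ℚ d → Vector (Vector ℚ d) 1
  line w _ = w

  reducible-by : Dec (Q ·ᵛ v ≗ 0ᵛ) → ¬ IrreduciblePair P Q
  reducible-by (yes Qv≗0) = reducible P Q (line v) (line v) 2≤d (nonzero⇒independent v v≢0) (nonzero⇒independent v v≢0)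
    (λ _ → zero∈ (Span (line v)) P·v≗0) (λ _ → zero∈ (Span (line v)) Qv≗0)
  reducible-by (no Qv≢0) = reducible P Q (line v) (line (Q ·ᵛ v)) 2≤d (nonzero⇒independent v v≢0) (nonzero⇒independent (Q ·ᵛ v) Qv≢0)
    (λ _ → zero∈ (Span (line (Q ·ᵛ v))) P·v≗0) (λ _ → Span-member (line (Q ·ᵛ v)) zero)

module _ {d} (P Q : Matrix ℚ d d) (P-inv : Invertible P) where

  private
    P⁻¹ = Invertible.inverse P-inv
    A   = P⁻¹ *ᴹ Q

  open Action A
  open Annihilator

  P-injective : ∀ v → P ·ᵛ v ≗ 0ᵛ → v ≗ 0ᵛ
  P-injective v Pv≗0 i = begin
    v i                    ≡⟨ inverse-·ᵛ P P⁻¹ (Invertible.inverseˡ P-inv) v i ⟨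
    (P⁻¹ ·ᵛ (P ·ᵛ v)) i    ≡⟨ ·ᵛ-cong P⁻¹ Pv≗0 i ⟩
    (P⁻¹ ·ᵛ 0ᵛ) i          ≡⟨ ·ᵛ-0 P⁻¹ i ⟩
    0ℚ                     ∎

  P·A≗Q : ∀ v → P ·ᵛ (A ·ᵛ v) ≗ Q ·ᵛ v
  P·A≗Q v i = ≡.trans (·ᵛ-cong P (*ᴹ-·ᵛ P⁻¹ Q v) i) (inverse-·ᵛ P⁻¹ P (Invertible.inverseʳ P-inv) (Q ·ᵛ v) i)

  annihilator⇒reducible : ∀ {m v} → ¬ v ≗ 0ᵛ → m < d → Annihilator v m → ¬ IrreduciblePair P Q
  annihilator⇒reducible {v = v} v≢0 m<d ann with minimalAnnihilator v ann
  ... | zero  , _   , ann′ , _     = contradiction ann′ (annihilator-degree≢0 v≢0)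
  ... | suc n , n≤m , ann′ , indep = reducible P Q b (λ j → P ·ᵛ b j) (ℕ.≤-<-trans n≤m m<d)
    indep (independent-·ᵛ P b P-injective indep) (Span-member (λ j → P ·ᵛ b j)) Qb∈
    where
    b = krylov (suc n) v
    Qb∈ : ∀ j → Q ·ᵛ b j ∈ Carrier (Span (λ j → P ·ᵛ b j))
    Qb∈ j = let c , Ab≗ = krylov-invariant ann′ (Span-member b j) in c , λ i → begin
      (Q ·ᵛ b j) i                    ≡⟨ P·A≗Q (b j) i ⟨
      (P ·ᵛ (A ·ᵛ b j)) i             ≡⟨ ·ᵛ-cong P Ab≗ i ⟩
      (P ·ᵛ linComb c b) i            ≡⟨ ·ᵛ-linComb P c b i ⟩
      linComb c (λ j → P ·ᵛ b j) i    ∎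

  module _ (irr : IrreduciblePair P Q) where

    no-small-factors : ∀ {i j a b} x y → 0 < d → i < d → j < d → a ≢ 0ℚ → b ≢ 0ℚ →
      LeadingTerm i a x → LeadingTerm j b y → ¬ charPoly A ≈ᴾ x *ᴾ y
    -- Matching `0 < d` exposes `d` as a successor, which supplies the index of `e₀`.
    no-small-factors {a = a} {b} x y (s≤s _) i<d j<d a≢0 b≢0 x↓ y↓ χ≈xy with Fin.all? (λ l → act y (1ᴹ zero) l ℚ.≟ 0ℚ)
    ... | yes yv≗0 = annihilator⇒reducible v≢0 j<d (record
      { poly = y ; lead = b ; lead≢0 = b≢0 ; leadingTerm = y↓ ; annihilates = yv≗0 }) irr
      where
      v≢0 : ¬ 1ᴹ zero ≗ 0ᵛ
      v≢0 v≗0 = contradiction (v≗0 zero) λ ()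
    ... | no yv≢0 = annihilator⇒reducible yv≢0 i<d (record
      { poly = x ; lead = a ; lead≢0 = a≢0 ; leadingTerm = x↓
      ; annihilates = λ l → begin
          act x (act y v) l     ≡⟨ act-* x y v l ⟨
          act (x *ᴾ y) v l      ≡⟨ act-resp (charPoly A) (x *ᴾ y) χ≈xy v l ⟨
          act (charPoly A) v l  ≡⟨ cayley-hamilton v l ⟩
          0ℚ                    ∎
      }) irr
      where v = 1ᴹ zero

    charPoly-irreducible : 0 < d → IrreduciblePoly (charPoly A)
    charPoly-irreducible 0<d = mkIrred
      (λ χ∣1 → ℕ.<⇒≢ 0<d (≡.sym (unit⇒degree-0 (λ ()) (charPoly-monic A) χ∣1)))
      (λ {x} {y} χ≈xy → split x y χ≈xy (factor-degrees x y (λ ()) (charPoly-monic A) χ≈xy))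
      where
      split : ∀ x y → charPoly A ≈ᴾ x *ᴾ y →
        (∃[ i ] ∃[ j ] ∃[ a ] ∃[ b ] a ≢ 0ℚ × b ≢ 0ℚ × LeadingTerm i a x × LeadingTerm j b y × i ℕ.+ j ≡ d) →
        Unit x ⊎ Unit y
      split x y χ≈xy (zero  , j     , a , b , a≢0 , b≢0 , x↓ , y↓ , _) = inj₁ (degree-0⇒unit a≢0 x↓)
      split x y χ≈xy (suc i , zero  , a , b , a≢0 , b≢0 , x↓ , y↓ , _) = inj₂ (degree-0⇒unit b≢0 y↓)
      split x y χ≈xy (suc i , suc j , a , b , a≢0 , b≢0 , x↓ , y↓ , i+j≡d) = contradiction χ≈xy
        (no-small-factors x y 0<d
          (≡.subst (suc i <_) i+j≡d (ℕ.m<m+n (suc i) (s≤s z≤n)))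
          (≡.subst (suc j <_) i+j≡d (ℕ.m<n+m (suc j) (s≤s z≤n))) a≢0 b≢0 x↓ y↓)

  module _ (χ-irr : IrreduciblePoly (charPoly A)) where

    -- Write `χ = qp` with `p` the minimal annihilator. If `p` is a unit, its degree is 0 and `v`
    -- would vanish; if `q` is a unit, `p` has the full degree `d`.
    annihilator-degree≥d : ∀ {m v} → ¬ v ≗ 0ᵛ → m < d → ¬ Annihilator v m
    annihilator-degree≥d {v = v} v≢0 m<d ann =
      let n , n≤m , ann′ , indep = minimalAnnihilator v ann
          q , χ≈qp = minimalAnnihilator-divides ann′ indep (charPoly A) (cayley-hamilton v)
      in impossible ann′ (ℕ.≤-<-trans n≤m m<d) q χ≈qp (Irreducible.split-∣1 χ-irr χ≈qp)
      where
      impossible : ∀ {n} (ann : Annihilator v n) → n < d → ∀ q → charPoly A ≈ᴾ q *ᴾ poly ann →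
        ¬ (Unit q ⊎ Unit (poly ann))
      impossible ann n<d q χ≈qp (inj₂ p-unit) with unit⇒degree-0 (lead≢0 ann) (leadingTerm ann) p-unit
      ... | ≡.refl = annihilator-degree≢0 v≢0 ann
      impossible {n} ann n<d q χ≈qp (inj₁ q-unit)
        with i , j , _ , _ , a≢0 , b≢0 , q↓ , p↓ , i+j≡d ← factor-degrees q (poly ann) (λ ()) (charPoly-monic A) χ≈qp
        with ≡.refl ← unit⇒degree-0 a≢0 q↓ q-unit =
          ℕ.<⇒≢ n<d (≡.trans (degree-unique (lead≢0 ann) b≢0 (leadingTerm ann) p↓) i+j≡d)

    charPoly-irreducible⇒irreduciblePair : IrreduciblePair P Q
    -- In dimension zero the empty family spans `U`, so all its members vanish.
    charPoly-irreducible⇒irreduciblePair (U , V , (U≢0 , _) , _ , (zero , (b , b-basis) , _) , _) =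
      U≢0 (λ u u∈U → proj₂ (IsBasis.spanning b-basis u∈U))
    charPoly-irreducible⇒irreduciblePair
      (U , V , (_ , U≢all) , _ , (suc k , (b , b-basis) , (b′ , b′-basis)) , PU⊆V , QU⊆V) =
        -- The `k + 2` vectors `u, Au, …` lie in `U`, which has dimension `k + 1`. They are
        -- therefore dependent and yield an annihilator of degree at most `k + 1`, hence below `d`.
        let n , n<k , ann = dependent⇒annihilator u (dependent-in-span (krylov (suc (suc k)) u) b
              (λ j → b-spanning (iterate-closed (toℕ j))) ℕ.≤-refl)
        in annihilator-degree≥d (independent⇒nonzero b b-independent zero) (ℕ.<-≤-trans n<k k<d) ann
      where
      open IsBasis b-basis renaming (member to b-member; spanning to b-spanning; independent to b-independent)
      u = b zero

      span⊆U : ∀ {w} → ∃[ c ] w ≗ linComb c b → w ∈ Carrier U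
      span⊆U (c , w≗) = Subspace.resp U (≡.sym ∘ w≗) (linComb-closed U c b b-member)

      -- Otherwise any `w` joined to the basis makes more than `d` vectors, so `w` lies in `U`, and
      -- `U` is the whole space.
      k<d : suc (suc k) ≤ d
      k<d with suc k ℕ.<? d
      ... | yes k<d = k<d
      ... | no k≮d  = contradiction
        (λ w → span⊆U (independent-∷⇒span b b-independent w (dependent-> (w ∷ᵛ b) (s≤s (ℕ.≮⇒≥ k≮d))))) U≢all

      -- PU has the dimension of V, so QU ⊆ V = PU.
      Q·w∈PU : ∀ {w} → w ∈ Carrier U → ∃[ c ] Q ·ᵛ w ≗ linComb c (λ j → P ·ᵛ b j)
      Q·w∈PU {w} w∈U = independent-∷⇒span (λ j → P ·ᵛ b j) (independent-·ᵛ P b P-injective b-independent) (Q ·ᵛ w)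
        (dependent-in-span ((Q ·ᵛ w) ∷ᵛ (λ j → P ·ᵛ b j)) b′
          (λ where
            zero    → IsBasis.spanning b′-basis (QU⊆V (w , w∈U , λ _ → ≡.refl))
            (suc j) → IsBasis.spanning b′-basis (PU⊆V (b j , b-member j , λ _ → ≡.refl)))
          ℕ.≤-refl)

      A-closed : ∀ {w} → w ∈ Carrier U → A ·ᵛ w ∈ Carrier U
      A-closed {w} w∈U = let c , Qw≗ = Q·w∈PU w∈U in span⊆U (c , λ i → begin
        (A ·ᵛ w) i                              ≡⟨ *ᴹ-·ᵛ P⁻¹ Q w i ⟩
        (P⁻¹ ·ᵛ (Q ·ᵛ w)) i                     ≡⟨ ·ᵛ-cong P⁻¹ Qw≗ i ⟩
        (P⁻¹ ·ᵛ linComb c (λ j → P ·ᵛ b j)) i   ≡⟨ ·ᵛ-cong P⁻¹ (·ᵛ-linComb P c b) i ⟨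
        (P⁻¹ ·ᵛ (P ·ᵛ linComb c b)) i           ≡⟨ inverse-·ᵛ P P⁻¹ (Invertible.inverseˡ P-inv) (linComb c b) i ⟩
        linComb c b i                           ∎)

      iterate-closed : ∀ n → iterate n u ∈ Carrier U
      iterate-closed zero    = b-member zero
      iterate-closed (suc n) = A-closed (iterate-closed n)

theorem5p2 : ∀ (d : ℕ) → 2 ≤ d → (P Q : Matrix ℚ d d) →
    IrreduciblePair P Q ⇔
    (Σ[ P-inv ∈ Invertible P ]
    (Invertible Q × IrreduciblePoly (charPoly (Invertible.inverse P-inv *ᴹ Q))))
theorem5p2 d 2≤d P Q = mk⇔
  (λ irr →
    let P-inv = independent⇒invertible P (irreducible⇒independent 2≤d P Q irr)
    in P-inv , independent⇒invertible Q (irreducible⇒independent 2≤d Q P (irreduciblePair-sym P Q irr)) ,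
       charPoly-irreducible P Q P-inv irr (ℕ.<⇒≤ 2≤d))
  (λ (P-inv , _ , χ-irr) → charPoly-irreducible⇒irreduciblePair P Q P-inv χ-irr)
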